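{- Let $\mathcal{A}=\{H_1,\ldots,H_m\}$ be a linear, essential hyperplane arrangement in $\mathbb{R}^n$ and let $0\le k<n$. Then the $\mathcal{A}$-matroid decomposition $$\mathrm{Gr}(k,n)=\bigsqcup_{\mathfrak{M}\in\mathbf{M}(\mathcal{A})}\Omega_{\mathcal{A}}(\mathfrak{M}),$$ the $\mathcal{A}$-adjoint decomposition $$\mathrm{Gr}(k,n)=\bigsqcup_{P\in L(\mathcal{A}^{(k)})}\mathcal{S}_P,$$ and the refined $\mathcal{A}$-Schubert decomposition $$\mathrm{Gr}(k,n)=\bigsqcup_{\sigma}\Omega_{\mathcal{A}}(\sigma)\qquad(\sigma\text{ ranging over the Schubert symbols of }\mathcal{A})$$ are exactly the same decomposition of the Grassmannian; that is, the set of nonempty strata $\Omega_{\mathcal{A}}(\mathfrak{M})$, the set of nonempty strata $\mathcal{S}_P$, and the set of nonempty strata $\Omega_{\mathcal{A}}(\sigma)$ are one and the same set of subsets of $\mathrm{Gr}(k,n)$.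
   Context: **Arrangements.** A hyperplane arrangement $\mathcal{A}$ in $\mathbb{R}^n$ is a finite set of hyperplanes; linear means that all hyperplanes pass through $0$, essential means $\bigcap_{H\in\mathcal{A}}H=\{0\}$. For any linear arrangement $\mathcal{A}$ in a vector space $V$, the intersection lattice $L(\mathcal{A})$ is the set of all subspaces $\bigcap_{H\in\mathcal{B}}H$, $\mathcal{B}\subseteq\mathcal{A}$ (the empty intersection being $V$), ordered by reverse inclusion: $X\le Y$ iff $Y\subseteq X$. For $X\in L(\mathcal{A})$, $\mathcal{A}$ in $\mathbb{R}^n$, $\mathrm{rank}(X)=n-\dim X$, and $L_k(\mathcal{A})=\{X\in L(\mathcal{A})\mid \mathrm{rank}(X)=k\}$. For $X\in L(\mathcal{A})$ put $X^\circ=X\setminus\bigcup_{Y\in L(\mathcal{A}),\,Y>X}Y$. **Plücker coordinates.** $[n]=\{1,\ldots,n\}$; $\binom{[n]}{k}$ is the set of $k$-subsets of $[n]$; $\mathbb{R}^{\binom{[n]}{k}}$ is the real vector space with coordinates indexed by $\binom{[n]}{k}$. $\mathrm{Gr}(k,n)$ is the set of $k$-dimensional subspaces of $\mathbb{R}^n$. For a $d$-dimensional subspace $U$ of $\mathbb{R}^n$, choose a $d\times n$ matrix $A$ whose row space is $U$ (a matrix representative); for $I\in\binom{[n]}{d}$, $\Delta_I(U)$ is the $d\times d$ minor of $A$ with column set $I$ (the minor is $1$ if $d=0$), and $\Delta(U)=(\Delta_I(U))_I$, which is well defined up to a common nonzero scalar. **$k$-adjoint.** For $0\le k<n$, $X\in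 L_k(\mathcal{A})$, $I\in\binom{[n]}{k}$, let $a_I(X)=(-1)^{\frac12k(k+1)+\sum_{i\in I}i}\Delta_{[n]\setminus I}(X)$. Let $H(X)=\{(x_I)_I\in\mathbb{R}^{\binom{[n]}{k}}\mid\sum_I a_I(X)x_I=0\}$, and let $\mathcal{A}^{(k)}=\{H(X)\mid X\in L_k(\mathcal{A})\}$, a hyperplane arrangement in $\mathbb{R}^{\binom{[n]}{k}}$. **$\mathcal{A}$-adjoint strata.** For $P\in L(\mathcal{A}^{(k)})$, $\mathcal{S}_P=\{U\in\mathrm{Gr}(k,n)\mid\Delta(U)\in P^\circ\}$. **$\mathcal{A}$-matroid strata.** Let $\alpha_i$ be a normal vector of $H_i$, so $H_i=\{v\mid\langle\alpha_i,v\rangle=0\}$ for the standard inner product. For $U\in\mathrm{Gr}(k,n)$ let $\beta_i$ be the orthogonal projection of $\alpha_i$ to $U$, and let $\mathfrak{M}_{\mathcal{A}}(U)$ be the matroid on $[m]$ with rank function $\mathrm{rank}(I)=\dim\mathrm{span}\{\beta_i\mid i\in I\}$. Let $\mathbf{M}(\mathcal{A})=\{\mathfrak{M}_{\mathcal{A}}(U)\mid U\in\mathrm{Gr}(k,n)\}$ and, for $\mathfrak{M}\in\mathbf{M}(\mathcal{A})$, $\Omega_{\mathcal{A}}(\mathfrak{M})=\{U\in\mathrm{Gr}(k,n)\mid\mathfrak{M}_{\mathcal{A}}(U)=\mathfrak{M}\}$ (equality of matroids on $[m]$). **Refined $\mathcal{A}$-Schubert strata.** For a complete flag $\boldsymbol{F}\colon\{0\}=F_0\subsetneq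 F_1\subsetneq\cdots\subsetneq F_n=\mathbb{R}^n$ with $\dim F_i=i$ and $\tau=\{i_1<\cdots<i_k\}\subseteq[n]$, the Schubert cell is $\Omega_{\boldsymbol{F}}(\tau)=\{U\in\mathrm{Gr}(k,n)\mid\dim(U\cap F_{i_l})>\dim(U\cap F_{i_l-1}),\ 1\le l\le k\}$. Every maximal chain of $L(\mathcal{A})$ is such a flag; let $\mathbf{mc}(L(\mathcal{A}))$ be the set of maximal chains. A Schubert symbol of $\mathcal{A}$ is a map $\sigma\colon\mathbf{mc}(L(\mathcal{A}))\to\binom{[n]}{k}$ such that $\Omega_{\mathcal{A}}(\sigma):=\bigcap_{\boldsymbol{F}\in\mathbf{mc}(L(\mathcal{A}))}\Omega_{\boldsymbol{F}}(\sigma(\boldsymbol{F}))\ne\varnothing$. -}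

module Defs where

open import Level using (Level; 0ℓ; _⊔_) renaming (suc to lsuc)
open import Algebra.Bundles using (CommutativeRing)
open import Data.Fin.Base using (Fin; zero; suc; toℕ; inject₁; punchIn)
open import Data.Fin.Subset using (Subset; ∣_∣; ∁; inside; outside)
import Data.Fin.Subset as Sub
open import Data.Fin.Subset.Properties using (∣∁p∣≡n∸∣p∣)
open import Data.Nat.Base as ℕ using (ℕ; zero; suc; _∸_; _/_)
open import Data.Product.Base using (Σ; ∃; _×_; _,_; proj₁; proj₂)
open import Data.Sum.Base using (_⊎_)
import Data.Vec.Base as Vec
open import Data.Vec.Functional as F using (Vector)
open import Relation.Binary.Core using (Rel)
open import Relation.Binary.PropositionalEquality.Core
  using (_≡_; refl; trans; cong)
open import Relation.Binary.Structures using (IsTotalOrder)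
open import Relation.Nullary.Negation.Core using (¬_)
open import Relation.Unary using (Pred; _⊆_; _⊂_; _≐_; _∩_; _⊥_; U; Satisfiable)

private
  variable
    a b c ℓ : Level
    d k m n : ℕ

------------------------------------------------------------------------
-- The real numbers
--
-- The library has no ℝ, so it is described by its categorical axioms: a
-- Dedekind-complete totally ordered field, unique up to isomorphism.

record RealNumbers : Set₁ where
  field
    commutativeRing : CommutativeRing 0ℓ 0ℓ

  open CommutativeRing commutativeRing public

  infix 4 _≤_

  field
    0≉1          : ¬ 0# ≈ 1#
    inverse      : ∀ x → ¬ x ≈ 0# → ∃ λ y → x * y ≈ 1#
    _≤_          : Rel Carrier 0ℓ
    isTotalOrder : IsTotalOrder _≈_ _≤_
    +-monoˡ-≤    : ∀ z {x y} → x ≤ y → x + z ≤ y + z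
    *-nonNeg     : ∀ {x y} → 0# ≤ x → 0# ≤ y → 0# ≤ x * y

  UpperBound : Pred Carrier 0ℓ → Pred Carrier 0ℓ
  UpperBound S b = ∀ {x} → S x → x ≤ b

  field
    supremum : (S : Pred Carrier 0ℓ) → Satisfiable S → Satisfiable (UpperBound S) →
               ∃ λ s → UpperBound S s × (∀ {b} → UpperBound S b → s ≤ b)

------------------------------------------------------------------------
-- Finite subsets

-- The k-subsets of [n]; the element i of [n] is the j : Fin n with
-- i = suc (toℕ j).
KSubset : ℕ → ℕ → Set
KSubset n k = ∃ λ (I : Subset n) → ∣ I ∣ ≡ k

complement : KSubset n k → KSubset n (n ∸ k)
complement {n} (I , ∣I∣≡k) = ∁ I , trans (∣∁p∣≡n∸∣p∣ I) (cong (n ∸_) ∣I∣≡k)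

-- The elements of I in increasing order.
element : (I : Subset n) → Fin ∣ I ∣ → Fin n
element (inside  Vec.∷ I) zero    = zero
element (inside  Vec.∷ I) (suc j) = suc (element I j)
element (outside Vec.∷ I) j       = suc (element I j)

elementSum : Subset n → ℕ
elementSum I = F.foldr ℕ._+_ 0 (λ j → suc (toℕ (element I j)))

------------------------------------------------------------------------
-- Matroids on [m], given by their rank functions

record Matroid (m : ℕ) : Set where
  field
    rank            : Subset m → ℕ
    rank≤∣∣         : ∀ I → rank I ℕ.≤ ∣ I ∣
    rank-mono       : ∀ {I J} → I Sub.⊆ J → rank I ℕ.≤ rank J
    rank-submodular : ∀ I J → rank (I Sub.∪ J) ℕ.+ rank (I Sub.∩ J) ℕ.≤ rank I ℕ.+ rank J

open Matroid public using (rank)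

------------------------------------------------------------------------
-- Decompositions
--
-- A family of subsets may contain empty members and, a priori, repeated
-- ones: _≈_ is the intended equality of indices.

record IsDecomposition {X : Set a} {I : Set b} (_≈_ : Rel I c) (S : I → Pred X ℓ)
       : Set (a ⊔ b ⊔ c ⊔ ℓ) where
  field
    covers   : ∀ x → ∃ λ i → S i x
    disjoint : ∀ {i j} → ¬ i ≈ j → S i ⊥ S j

NonemptyStrata : {X : Set (lsuc 0ℓ)} {I : Set (lsuc 0ℓ)} → (I → Pred X ℓ) →
                 Pred (Pred X (lsuc 0ℓ)) (lsuc 0ℓ ⊔ ℓ)
NonemptyStrata S Z = Satisfiable Z × ∃ λ i → Z ≐ S i

------------------------------------------------------------------------
-- Arrangements in an arbitrary space V
--
-- An arrangement is a set of subsets of V.  Subfamilies and intersections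
-- are taken at the lowest universe level, which under excluded middle
-- loses no generality, every proposition then being equivalent to a small
-- one.

module _ {V : Set} where

  ⋂ : Pred (Pred V 0ℓ) ℓ → Pred V (lsuc 0ℓ ⊔ ℓ)
  ⋂ ℬ v = ∀ H → ℬ H → H v

  -- The order of the intersection lattice is reverse inclusion.
  L : Pred (Pred V 0ℓ) ℓ → Pred (Pred V 0ℓ) (lsuc 0ℓ ⊔ ℓ)
  L 𝒜 X = Σ (Pred (Pred V 0ℓ) 0ℓ) λ ℬ → ℬ ⊆ 𝒜 × X ≐ ⋂ ℬ

  openStratum : Pred (Pred V 0ℓ) ℓ → Pred V 0ℓ → Pred V (lsuc 0ℓ ⊔ ℓ)
  openStratum 𝒜 X x = X x × (∀ Y → L 𝒜 Y → Y ⊂ X → ¬ Y x)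

  IsChain : Pred (Pred V 0ℓ) 0ℓ → Set₁
  IsChain C = ∀ {X Y} → C X → C Y → X ⊆ Y ⊎ Y ⊆ X

  record MaximalChain (𝒜 : Pred (Pred V 0ℓ) ℓ) : Set (lsuc 0ℓ ⊔ ℓ) where
    field
      members : Pred (Pred V 0ℓ) 0ℓ
      flats   : members ⊆ L 𝒜
      isChain : IsChain members
      maximal : ∀ D → D ⊆ L 𝒜 → IsChain D → members ⊆ D → D ⊆ members

  open MaximalChain public using (members)

module Over (ℝ : RealNumbers) where

  open RealNumbers ℝ
    using (Carrier; _≈_; _+_; _*_; _-_; -_; 0#; 1#; setoid; semiring)
  open import Algebra.Properties.Semiring.Exp semiring using (_^_)
  open import Algebra.Properties.Semiring.Sum semiring using (sum)
  open import Data.Vec.Functional.Relation.Binary.Equality.Setoid setoid public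
    using (_≋_)

  ----------------------------------------------------------------------
  -- Linear algebra in ℝⁿ

  ℝ^ : ℕ → Set
  ℝ^ n = Vector Carrier n

  𝟎 : ℝ^ n
  𝟎 _ = 0#

  ⟨_,_⟩ : ℝ^ n → ℝ^ n → Carrier
  ⟨ u , v ⟩ = sum (λ j → u j * v j)

  Matrix : ℕ → ℕ → Set
  Matrix d n = Fin d → ℝ^ n

  combination : ℝ^ d → Matrix d n → ℝ^ n
  combination c A j = sum (λ i → c i * A i j)

  -- The span of the rows of A indexed by I.
  SpanOf : Matrix d n → Subset d → Pred (ℝ^ n) 0ℓ
  SpanOf A I v = ∃ λ c → (∀ i → i Sub.∉ I → c i ≈ 0#) × v ≋ combination c A

  RowSpace : Matrix d n → Pred (ℝ^ n) 0ℓ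
  RowSpace A v = ∃ λ c → v ≋ combination c A

  LinearlyIndependent : Matrix d n → Set
  LinearlyIndependent A = ∀ c → combination c A ≋ 𝟎 → ∀ i → c i ≈ 0#

  IsBasis : Matrix d n → Pred (ℝ^ n) 0ℓ → Set
  IsBasis A W = LinearlyIndependent A × W ≐ RowSpace A

  HasDim : Pred (ℝ^ n) 0ℓ → ℕ → Set
  HasDim {n} W d = ∃ λ (A : Matrix d n) → IsBasis A W

  det : Matrix d d → Carrier
  det {zero}  A = 1#
  det {suc d} A =
    sum (λ j → (- 1#) ^ toℕ j * A zero j * det (λ r c → A (suc r) (punchIn j c)))

  minor : Matrix d n → KSubset n d → Carrier
  minor A (I , refl) = det (λ r c → A r (element I c))

  ----------------------------------------------------------------------
  -- Grassmannians

  -- A k-dimensional subspace together with a chosen matrix representative;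
  -- points are compared through their carriers only.  Being equal to a row
  -- space, the carrier is automatically a subspace.
  record Gr (k n : ℕ) : Set₁ where
    field
      carrier : Pred (ℝ^ n) 0ℓ
      basis   : Matrix k n
      isBasis : IsBasis basis carrier

  open Gr public

  Coordinates : ℕ → ℕ → Set
  Coordinates n k = KSubset n k → Carrier

  Δ : Gr k n → Coordinates n k
  Δ W = minor (basis W)

  -- Summation over all k-subsets of [n], split by whether they contain the
  -- first element.
  ∑ₛ : ∀ n k → (KSubset n k → Carrier) → Carrier
  ∑ₛ zero    zero    f = f (Vec.[] , refl)
  ∑ₛ zero    (suc k) f = 0#
  ∑ₛ (suc n) zero    f = ∑ₛ n zero (λ (I , p) → f (outside Vec.∷ I , p))
  ∑ₛ (suc n) (suc k) f = ∑ₛ n k       (λ (I , p) → f (inside  Vec.∷ I , cong suc p))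
                       + ∑ₛ n (suc k) (λ (I , p) → f (outside Vec.∷ I , p))

  ----------------------------------------------------------------------
  -- Linear arrangements in ℝⁿ, given by normal vectors

  hyperplane : ℝ^ n → Pred (ℝ^ n) 0ℓ
  hyperplane α v = ⟨ α , v ⟩ ≈ 0#

  Arrangement : (Fin m → ℝ^ n) → Pred (Pred (ℝ^ n) 0ℓ) 0ℓ
  Arrangement α H = ∃ λ i → H ≐ hyperplane (α i)

  Essential : Pred (Pred (ℝ^ n) 0ℓ) ℓ → Set (lsuc 0ℓ ⊔ ℓ)
  Essential 𝒜 = ⋂ 𝒜 ≐ (_≋ 𝟎)

  ----------------------------------------------------------------------
  -- Adjoint strata

  adjointCoefficient : Gr (n ∸ k) n → Coordinates n k
  adjointCoefficient {k = k} X I =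
    (- 1#) ^ (k ℕ.* suc k / 2 ℕ.+ elementSum (proj₁ I)) * Δ X (complement I)

  -- The chosen representative of X only affects the coefficients by a
  -- common nonzero factor.
  adjointHyperplane : Gr (n ∸ k) n → Pred (Coordinates n k) 0ℓ
  adjointHyperplane {n} {k} X x = ∑ₛ n k (λ I → adjointCoefficient X I * x I) ≈ 0#

  -- For k ≤ n, a flat has rank k iff it has dimension n ∸ k.
  Adjoint : Pred (Pred (ℝ^ n) 0ℓ) 0ℓ → ∀ k → Pred (Pred (Coordinates n k) 0ℓ) (lsuc 0ℓ)
  Adjoint {n} 𝒜 k H =
    ∃ λ (X : Gr (n ∸ k) n) → L 𝒜 (carrier X) × H ≐ adjointHyperplane {n} {k} X

  AdjointFlat : Pred (Pred (ℝ^ n) 0ℓ) 0ℓ → ℕ → Set₁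
  AdjointFlat 𝒜 k = Σ (Pred (Coordinates _ k) 0ℓ) (L (Adjoint 𝒜 k))

  adjointStratum : (𝒜 : Pred (Pred (ℝ^ n) 0ℓ) 0ℓ) → AdjointFlat 𝒜 k →
                   Pred (Gr k n) (lsuc 0ℓ)
  adjointStratum {k = k} 𝒜 (P , _) W = openStratum (Adjoint 𝒜 k) P (Δ W)

  _≈ᴾ_ : {𝒜 : Pred (Pred (ℝ^ n) 0ℓ) 0ℓ} → Rel (AdjointFlat 𝒜 k) 0ℓ
  (P , _) ≈ᴾ (Q , _) = P ≐ Q

  ----------------------------------------------------------------------
  -- Matroid strata

  IsOrthogonalProjection : Pred (ℝ^ n) 0ℓ → ℝ^ n → ℝ^ n → Set
  IsOrthogonalProjection W α β = W β × (∀ w → W w → ⟨ (λ j → α j - β j) , w ⟩ ≈ 0#)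

  -- 𝔐 is the matroid of the projections of the α i to W.
  matroidStratumOf : (Fin m → ℝ^ n) → Matroid m → Pred (Gr k n) 0ℓ
  matroidStratumOf {m} {n} α 𝔐 W =
    ∃ λ (β : Fin m → ℝ^ n) →
      (∀ i → IsOrthogonalProjection (carrier W) (α i) (β i)) ×
      (∀ I → HasDim (SpanOf β I) (rank 𝔐 I))

  ArrangementMatroid : (Fin m → ℝ^ n) → ℕ → Set₁
  ArrangementMatroid {m} {n} α k =
    Σ (Matroid m) λ 𝔐 → Satisfiable (matroidStratumOf {k = k} α 𝔐)

  matroidStratum : (α : Fin m → ℝ^ n) → ArrangementMatroid α k → Pred (Gr k n) 0ℓ
  matroidStratum α (𝔐 , _) = matroidStratumOf α 𝔐

  _≈ᴹ_ : {α : Fin m → ℝ^ n} → Rel (ArrangementMatroid α k) 0ℓ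
  (𝔐 , _) ≈ᴹ (𝔑 , _) = ∀ I → rank 𝔐 I ≡ rank 𝔑 I

  ----------------------------------------------------------------------
  -- Refined Schubert strata

  record CompleteFlag (n : ℕ) : Set₁ where
    field
      space  : Fin (suc n) → Pred (ℝ^ n) 0ℓ
      hasDim : ∀ i → HasDim (space i) (toℕ i)
      strict : ∀ (i : Fin n) → space (inject₁ i) ⊂ space (suc i)

  open CompleteFlag public using (space)

  schubertCell : CompleteFlag n → KSubset n k → Pred (Gr k n) 0ℓ
  schubertCell Φ (τ , _) W = ∀ i → i Sub.∈ τ →
    ∃ λ d → ∃ λ e →
      HasDim (carrier W ∩ space Φ (suc i)) d ×
      HasDim (carrier W ∩ space Φ (inject₁ i)) e ×
      e ℕ.< d

  -- The members of C are exactly the spaces of the flag Φ, which C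
  -- determines.
  _IsFlag_ : {𝒜 : Pred (Pred (ℝ^ n) 0ℓ) 0ℓ} → MaximalChain 𝒜 → CompleteFlag n → Set₁
  C IsFlag Φ = members C ≐ (λ X → ∃ λ i → X ≐ space Φ i)

  schubertStratumOf : (𝒜 : Pred (Pred (ℝ^ n) 0ℓ) 0ℓ) →
                      (MaximalChain 𝒜 → KSubset n k) → Pred (Gr k n) (lsuc 0ℓ)
  schubertStratumOf {n} 𝒜 σ W =
    (C : MaximalChain 𝒜) →
      ∃ λ (Φ : CompleteFlag n) → C IsFlag Φ × schubertCell Φ (σ C) W

  record SchubertSymbol (𝒜 : Pred (Pred (ℝ^ n) 0ℓ) 0ℓ) (k : ℕ) : Set₁ where
    field
      symbol   : MaximalChain 𝒜 → KSubset n k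
      respects : ∀ C D → members C ≐ members D → proj₁ (symbol C) ≡ proj₁ (symbol D)
      nonempty : Satisfiable (schubertStratumOf 𝒜 symbol)

  open SchubertSymbol public using (symbol)

  schubertStratum : (𝒜 : Pred (Pred (ℝ^ n) 0ℓ) 0ℓ) → SchubertSymbol 𝒜 k →
                    Pred (Gr k n) (lsuc 0ℓ)
  schubertStratum 𝒜 σ = schubertStratumOf 𝒜 (symbol σ)

  _≈ˢ_ : {𝒜 : Pred (Pred (ℝ^ n) 0ℓ) 0ℓ} → Rel (SchubertSymbol 𝒜 k) (lsuc 0ℓ)
  σ ≈ˢ τ = ∀ C → proj₁ (symbol σ C) ≡ proj₁ (symbol τ C)

module Submission where

-- Call W and W′ equivalent when they meet every flat of the arrangement in the
-- same dimension; each of the three decompositions turns out to consist of the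
-- equivalence classes.
--
-- Matroid strata: by orthogonality inside W, the rank of I and the dimension of
-- the intersection of W with the flat of I add up to k.
--
-- Adjoint strata: by Laplace expansion Δ W lies on the hyperplane of X exactly
-- when the rows of W and X are dependent, i.e. when W meets X nontrivially.
-- Hence a stratum fixes which flats X of rank k satisfy W ∩ X = 0.  These are
-- the flats cut out by the bases of the matroid of W, and bases determine ranks.
--
-- Schubert strata: a maximal chain of flats is a complete flag, along which the
-- dimension of the intersection with W grows by steps of at most one; the k
-- places where it grows determine all these dimensions, and every flat lies on
-- a maximal chain.

open import Defs
open import Level as Level using (0ℓ; lift; lower; Lift) renaming (suc to lsuc)
open import Axiom.ExcludedMiddle using (ExcludedMiddle)
open import Algebra.Bundles using (RawRing)
import Algebra.Properties.Ring as RingProperties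
import Algebra.Solver.Ring as RingSolver
open import Algebra.Solver.Ring.AlmostCommutativeRing using (fromCommutativeRing; _-Raw-AlmostCommutative⟶_)
open import Data.Empty using (⊥)
open import Data.Unit.Base using (⊤; tt)
open import Data.Fin.Base using (Fin; zero; suc; toℕ; fromℕ; fromℕ<; inject₁; punchIn; punchOut; splitAt; _↑ˡ_; _↑ʳ_)
import Data.Fin.Properties as Finₚ
open import Data.Fin.Subset using (Subset; inside; outside; ∣_∣; ∁)
import Data.Fin.Subset as Sub
import Data.Fin.Subset.Properties as Subₚ
open import Data.List.Base using (List; []; _∷_; _++_; tabulate)
import Data.List.Base as List
import Data.List.Properties as Listₚ
open import Data.Maybe.Base using (Maybe; just; nothing)
open import Data.Nat.Base as ℕ using (ℕ; zero; suc; _<_; _∸_; z≤n; s≤s)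
import Data.Nat.Properties as ℕₚ
open import Data.Product.Base using (∃; _×_; _,_; proj₁; proj₂; swap)
open import Data.Sum.Base using (_⊎_; inj₁; inj₂)
import Data.Vec.Base as Vec
import Data.Vec.Properties as Vecₚ
open import Data.Vec.Functional as F using (Vector)
import Data.Vec.Functional.Properties as Fₚ
open import Function.Base using (_∘_; id; case_of_; const)
open import Relation.Binary.PropositionalEquality as ≡ using (_≡_; _≗_)
import Relation.Binary.Reasoning.Setoid as SetoidReasoning
open import Relation.Nullary using (¬_; Dec; yes; no; contradiction)
open import Relation.Nullary.Decidable using (does; decidable-stable; dec-true; True; toWitness; fromWitness)
open import Relation.Unary using (Pred; _⊆_; _⊂_; _≐_; _∩_)
open import Relation.Binary.Structures using (IsTotalOrder)

-- Pairwise comparison of the decompositions is avoided by one abstract pattern, `Classifies`: every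
-- point is covered, points of one stratum are equivalent, and a stratum is closed under
-- equivalence. Two families of this kind have the same nonempty strata, whatever their indices are.
--
-- The obstacle is that adjoint hyperplanes see only the flats of rank k, and of each only whether
-- it meets W in zero, whereas equivalence asks for dimensions at all flats. The gap is closed by an
-- inequality of dimensions that follows from a one-sided hypothesis and is applied in both
-- directions.
--
-- Determinants are taken over lists, where deleting a column and deleting a row are the same
-- operation; expansion along a column, on which the Laplace formula rests, then costs a single
-- exchange of sums.

module Development (em : ExcludedMiddle (lsuc 0ℓ)) (ℝ : RealNumbers) where

  open RealNumbers ℝ hiding (zero)
  open Over ℝ
  open RingProperties ring
  open import Algebra.Properties.Semiring.Exp semiring using (_^_; ^-homo-*)
  open import Algebra.Properties.Semiring.Sum semiring
  open import Algebra.Properties.Semiring.Mult.TCOptimised semiring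
    using (×-homo-+; ×1-homo-*) renaming (_×_ to _·_)

  private module ≈R = SetoidReasoning setoid

  -- Excluded middle at the levels in use, and the ring solver

  decide : (P : Set₁) → Dec P
  decide P = em

  decide₀ : (P : Set) → Dec P
  decide₀ P with decide (Lift (lsuc 0ℓ) P)
  ... | yes p = yes (lower p)
  ... | no ¬p = no (¬p ∘ lift)

  _≈?_ : ∀ x y → Dec (x ≈ y)
  x ≈? y = decide₀ (x ≈ y)

  ¬¬-elim : {P : Set} → ¬ ¬ P → P
  ¬¬-elim {P} = decidable-stable (decide₀ P)

  -- Coefficients for the ring solver: formal differences of naturals.
  difference : ℕ × ℕ → Carrier
  difference (a , b) = a · 1# - b · 1#

  private
    rawDifferences : RawRing 0ℓ 0ℓ
    rawDifferences = record
      { Carrier = ℕ × ℕ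
      ; _≈_     = _≡_
      ; _+_     = λ (a , b) (c , d) → a ℕ.+ c , b ℕ.+ d
      ; _*_     = λ (a , b) (c , d) → a ℕ.* c ℕ.+ b ℕ.* d , a ℕ.* d ℕ.+ b ℕ.* c
      ; -_      = swap
      ; 0#      = 0 , 0
      ; 1#      = 1 , 0
      }

    swap-middle : ∀ x y z w → (x + y) + (z + w) ≈ (x + z) + (y + w)
    swap-middle x y z w = begin
      (x + y) + (z + w) ≈⟨ +-assoc _ _ _ ⟩
      x + (y + (z + w)) ≈⟨ +-congˡ (+-assoc _ _ _) ⟨
      x + ((y + z) + w) ≈⟨ +-congˡ (+-congʳ (+-comm _ _)) ⟩
      x + ((z + y) + w) ≈⟨ +-congˡ (+-assoc _ _ _) ⟩
      x + (z + (y + w)) ≈⟨ +-assoc _ _ _ ⟨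
      (x + z) + (y + w) ∎
      where open ≈R

    difference-+ : ∀ x y z w → (x + z) - (y + w) ≈ (x - y) + (z - w)
    difference-+ x y z w =
      trans (+-congˡ (sym (-‿+-comm y w))) (swap-middle x z (- y) (- w))

    difference-* : ∀ x y z w → (x * z + y * w) - (x * w + y * z) ≈ (x - y) * (z - w)
    difference-* x y z w = begin
      (x * z + y * w) - (x * w + y * z)             ≈⟨ difference-+ _ _ _ _ ⟩
      (x * z - x * w) + (y * w - y * z)             ≈⟨ +-cong (sym (x[y-z]≈xy-xz x z w)) (sym (x[y-z]≈xy-xz y w z)) ⟩
      x * (z - w) + y * (w - z)                     ≈⟨ +-congˡ (*-congˡ (⁻¹-anti-homo‿- z w)) ⟨
      x * (z - w) + y * (- (z - w))                 ≈⟨ +-congˡ (-‿distribʳ-* y (z - w)) ⟨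
      x * (z - w) - y * (z - w)                     ≈⟨ [y-z]x≈yx-zx (z - w) x y ⟨
      (x - y) * (z - w) ∎
      where open ≈R

    difference-homomorphism : rawDifferences -Raw-AlmostCommutative⟶ fromCommutativeRing commutativeRing
    difference-homomorphism = record
      { ⟦_⟧    = difference
      ; +-homo = λ (a , b) (c , d) →
          trans (+-cong (×-homo-+ 1# a c) (-‿cong (×-homo-+ 1# b d))) (difference-+ _ _ _ _)
      ; *-homo = λ (a , b) (c , d) →
          trans (+-cong (trans (×-homo-+ 1# (a ℕ.* c) (b ℕ.* d)) (+-cong (×1-homo-* a c) (×1-homo-* b d)))
                        (-‿cong (trans (×-homo-+ 1# (a ℕ.* d) (b ℕ.* c)) (+-cong (×1-homo-* a d) (×1-homo-* b c)))))
                (difference-* _ _ _ _)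
      ; -‿homo = λ (a , b) → sym (⁻¹-anti-homo‿- (a · 1#) (b · 1#))
      ; 0-homo = -‿inverseʳ 0#
      ; 1-homo = trans (+-congˡ -0#≈0#) (+-identityʳ 1#)
      }

    difference-≟ : ∀ p q → Maybe (difference p ≈ difference q)
    difference-≟ (a , b) (c , d) with a ℕ.+ d ℕₚ.≟ c ℕ.+ b
    ... | no _  = nothing
    ... | yes e = just (x∙y⁻¹≈ε⇒x≈y _ _ (begin
      (x - y) - (z - w)  ≈⟨ +-congˡ (⁻¹-anti-homo‿- z w) ⟩
      (x - y) + (w - z)  ≈⟨ difference-+ x y w z ⟨
      (x + w) - (y + z)  ≈⟨ x≈y⇒x∙y⁻¹≈ε (trans (sym (×-homo-+ 1# a d)) (trans (reflexive (≡.cong (_· 1#) e)) (trans (×-homo-+ 1# c b) (+-comm z y)))) ⟩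
      0# ∎))
      where
      open ≈R
      x = a · 1#
      y = b · 1#
      z = c · 1#
      w = d · 1#

  open RingSolver rawDifferences (fromCommutativeRing commutativeRing)
    difference-homomorphism difference-≟ public
    using (solve; _:+_; _:*_; _:-_; :-_; _:=_)

  -- Consequences of the field and order axioms

  *-cancelˡ-zero : ∀ {x y} → x ≉ 0# → x * y ≈ 0# → y ≈ 0#
  *-cancelˡ-zero {x} {y} x≉0 xy≈0 with inverse x x≉0
  ... | x⁻¹ , xx⁻¹≈1 = begin
    y               ≈⟨ *-identityˡ y ⟨
    1# * y          ≈⟨ *-congʳ xx⁻¹≈1 ⟨
    x * x⁻¹ * y     ≈⟨ solve 3 (λ x i y → x :* i :* y := i :* (x :* y)) refl x x⁻¹ y ⟩
    x⁻¹ * (x * y)   ≈⟨ *-congˡ xy≈0 ⟩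
    x⁻¹ * 0#        ≈⟨ zeroʳ _ ⟩
    0#              ∎
    where open ≈R

  -1≉0 : - 1# ≉ 0#
  -1≉0 e = 0≉1 (begin
    0#        ≈⟨ -0#≈0# ⟨
    - 0#      ≈⟨ -‿cong e ⟨
    - (- 1#)  ≈⟨ -‿involutive 1# ⟩
    1#        ∎)
    where open ≈R

  *-≉0 : ∀ {x y} → x ≉ 0# → y ≉ 0# → x * y ≉ 0#
  *-≉0 x≉0 y≉0 = y≉0 ∘ *-cancelˡ-zero x≉0

  ^-≉0 : ∀ {x} n → x ≉ 0# → x ^ n ≉ 0#
  ^-≉0 zero    x≉0 e = 0≉1 (sym e)
  ^-≉0 (suc n) x≉0   = *-≉0 x≉0 (^-≉0 n x≉0)

  private module ≤ = IsTotalOrder isTotalOrder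

  0≤-neg : ∀ {x} → x ≤ 0# → 0# ≤ - x
  0≤-neg {x} x≤0 = ≤.trans (≤.reflexive (sym (-‿inverseʳ x)))
    (≤.trans (+-monoˡ-≤ (- x) x≤0) (≤.reflexive (+-identityˡ _)))

  0≤x*x : ∀ x → 0# ≤ x * x
  0≤x*x x with ≤.total 0# x
  ... | inj₁ 0≤x = *-nonNeg 0≤x 0≤x
  ... | inj₂ x≤0 = ≤.trans (*-nonNeg (0≤-neg x≤0) (0≤-neg x≤0))
    (≤.reflexive (solve 1 (λ x → (:- x) :* (:- x) := x :* x) refl x))

  x≤x+y : ∀ {x y} → 0# ≤ y → x ≤ x + y
  x≤x+y {x} {y} 0≤y = ≤.trans (≤.reflexive (sym (+-identityˡ x)))
    (≤.trans (+-monoˡ-≤ x 0≤y) (≤.reflexive (+-comm y x)))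

  sum-nonNeg : ∀ {n} (f : Vector Carrier n) → (∀ i → 0# ≤ f i) → 0# ≤ sum f
  sum-nonNeg {zero}  f 0≤f = ≤.reflexive refl
  sum-nonNeg {suc n} f 0≤f = ≤.trans (0≤f zero) (x≤x+y (sum-nonNeg (f ∘ suc) (0≤f ∘ suc)))

  sum-nonNeg-zero : ∀ {n} (f : Vector Carrier n) → (∀ i → 0# ≤ f i) → sum f ≈ 0# → ∀ i → f i ≈ 0#
  sum-nonNeg-zero {suc n} f 0≤f s≈0 zero    =
    ≤.antisym (≤.trans (x≤x+y (sum-nonNeg (f ∘ suc) (0≤f ∘ suc))) (≤.reflexive s≈0)) (0≤f zero)
  sum-nonNeg-zero {suc n} f 0≤f s≈0 (suc i) =
    sum-nonNeg-zero (f ∘ suc) (0≤f ∘ suc)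
      (≤.antisym (≤.trans (x≤x+y (0≤f zero)) (≤.reflexive (trans (+-comm _ _) s≈0)))
                 (sum-nonNeg (f ∘ suc) (0≤f ∘ suc))) i

  sum-zero : ∀ {n} {f : Vector Carrier n} → (∀ i → f i ≈ 0#) → sum f ≈ 0#
  sum-zero {n} f≈0 = trans (sum-cong-≋ f≈0) (sum-replicate-zero n)

  -- The inner product and linear combinations

  ⟨⟩-cong : ∀ {n} {u u′ v v′ : ℝ^ n} → u ≋ u′ → v ≋ v′ → ⟨ u , v ⟩ ≈ ⟨ u′ , v′ ⟩
  ⟨⟩-cong u≋ v≋ = sum-cong-≋ (λ i → *-cong (u≋ i) (v≋ i))

  ⟨⟩-comm : ∀ {n} (u v : ℝ^ n) → ⟨ u , v ⟩ ≈ ⟨ v , u ⟩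
  ⟨⟩-comm u v = sum-cong-≋ (λ i → *-comm (u i) (v i))

  -- The order of the reals enters the proof only through this lemma: squares are nonnegative, so a
  -- vanishing sum of squares vanishes term by term.
  ⟨⟩-definite : ∀ {n} (v : ℝ^ n) → ⟨ v , v ⟩ ≈ 0# → v ≋ 𝟎
  ⟨⟩-definite v e i with v i ≈? 0#
  ... | yes vᵢ≈0 = vᵢ≈0
  ... | no  vᵢ≉0 = *-cancelˡ-zero vᵢ≉0 (sum-nonNeg-zero _ (λ j → 0≤x*x (v j)) e i)

  infixl 6 _⊕_ _⊖_
  infixr 7 _⊙_

  _⊕_ _⊖_ : ∀ {n} → ℝ^ n → ℝ^ n → ℝ^ n
  (u ⊕ v) j = u j + v j
  (u ⊖ v) j = u j - v j

  _⊙_ : ∀ {n} → Carrier → ℝ^ n → ℝ^ n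
  (c ⊙ v) j = c * v j

  ⟨⟩-⊕ʳ : ∀ {n} (u v w : ℝ^ n) → ⟨ u , v ⊕ w ⟩ ≈ ⟨ u , v ⟩ + ⟨ u , w ⟩
  ⟨⟩-⊕ʳ u v w = trans (sum-cong-≋ (λ i → distribˡ (u i) (v i) (w i)))
    (∑-distrib-+ (λ i → u i * v i) (λ i → u i * w i))

  ⟨⟩-⊙ʳ : ∀ {n} (u : ℝ^ n) c (v : ℝ^ n) → ⟨ u , c ⊙ v ⟩ ≈ c * ⟨ u , v ⟩
  ⟨⟩-⊙ʳ u c v = trans
    (sum-cong-≋ (λ i → solve 3 (λ u c v → u :* (c :* v) := c :* (u :* v)) refl (u i) c (v i)))
    (sym (*-distribˡ-sum c (λ i → u i * v i)))

  ⟨⟩-⊕ˡ : ∀ {n} (u v w : ℝ^ n) → ⟨ u ⊕ v , w ⟩ ≈ ⟨ u , w ⟩ + ⟨ v , w ⟩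
  ⟨⟩-⊕ˡ u v w = trans (⟨⟩-comm (u ⊕ v) w) (trans (⟨⟩-⊕ʳ w u v) (+-cong (⟨⟩-comm w u) (⟨⟩-comm w v)))

  ⟨⟩-⊙ˡ : ∀ {n} c (u v : ℝ^ n) → ⟨ c ⊙ u , v ⟩ ≈ c * ⟨ u , v ⟩
  ⟨⟩-⊙ˡ c u v = trans (⟨⟩-comm (c ⊙ u) v) (trans (⟨⟩-⊙ʳ v c u) (*-congˡ (⟨⟩-comm v u)))

  ⟨⟩-𝟎ʳ : ∀ {n} (u : ℝ^ n) → ⟨ u , 𝟎 ⟩ ≈ 0#
  ⟨⟩-𝟎ʳ u = sum-zero (λ i → zeroʳ (u i))

  ⊖≋⊕ : ∀ {n} (u v : ℝ^ n) → u ⊖ v ≋ u ⊕ (- 1#) ⊙ v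
  ⊖≋⊕ u v i = +-congˡ (sym (-1*x≈-x (v i)))

  ⟨⟩-⊖ˡ : ∀ {n} (u v w : ℝ^ n) → ⟨ u ⊖ v , w ⟩ ≈ ⟨ u , w ⟩ - ⟨ v , w ⟩
  ⟨⟩-⊖ˡ u v w = begin
    ⟨ u ⊖ v , w ⟩                     ≈⟨ ⟨⟩-cong (⊖≋⊕ u v) (λ _ → refl) ⟩
    ⟨ u ⊕ (- 1#) ⊙ v , w ⟩            ≈⟨ ⟨⟩-⊕ˡ u _ w ⟩
    ⟨ u , w ⟩ + ⟨ (- 1#) ⊙ v , w ⟩    ≈⟨ +-congˡ (trans (⟨⟩-⊙ˡ _ v w) (-1*x≈-x _)) ⟩
    ⟨ u , w ⟩ - ⟨ v , w ⟩             ∎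
    where open ≈R

  ⟨⟩-combinationʳ : ∀ {d n} (u : ℝ^ n) (c : ℝ^ d) (A : Matrix d n) →
                    ⟨ u , combination c A ⟩ ≈ sum (λ i → c i * ⟨ u , A i ⟩)
  ⟨⟩-combinationʳ {zero}  u c A = ⟨⟩-𝟎ʳ u
  ⟨⟩-combinationʳ {suc d} u c A = begin
    ⟨ u , combination c A ⟩                                            ≈⟨ ⟨⟩-⊕ʳ u (c zero ⊙ A zero) _ ⟩
    ⟨ u , c zero ⊙ A zero ⟩ + ⟨ u , combination (c ∘ suc) (A ∘ suc) ⟩  ≈⟨ +-cong (⟨⟩-⊙ʳ u (c zero) (A zero)) (⟨⟩-combinationʳ u (c ∘ suc) (A ∘ suc)) ⟩
    sum (λ i → c i * ⟨ u , A i ⟩)                                      ∎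
    where open ≈R

  combination-cong : ∀ {d n} {c c′ : ℝ^ d} (A : Matrix d n) → c ≋ c′ → combination c A ≋ combination c′ A
  combination-cong A c≋ j = sum-cong-≋ (λ i → *-congʳ (c≋ i))

  combination-congʳ : ∀ {d n} (c : ℝ^ d) {A B : Matrix d n} → (∀ i → A i ≋ B i) → combination c A ≋ combination c B
  combination-congʳ c A≋ j = sum-cong-≋ (λ i → *-congˡ (A≋ i j))

  combination-⊕ : ∀ {d n} (c c′ : ℝ^ d) (A : Matrix d n) →
                  combination (c ⊕ c′) A ≋ combination c A ⊕ combination c′ A
  combination-⊕ c c′ A j = trans (sum-cong-≋ (λ i → distribʳ (A i j) (c i) (c′ i)))
    (∑-distrib-+ (λ i → c i * A i j) (λ i → c′ i * A i j))

  combination-⊙ : ∀ {d n} s (c : ℝ^ d) (A : Matrix d n) → combination (s ⊙ c) A ≋ s ⊙ combination c A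
  combination-⊙ s c A j = trans (sum-cong-≋ (λ i → *-assoc s (c i) (A i j))) (sym (*-distribˡ-sum s (λ i → c i * A i j)))

  combination-𝟎 : ∀ {d n} (A : Matrix d n) → combination 𝟎 A ≋ 𝟎
  combination-𝟎 A j = sum-zero (λ i → zeroˡ (A i j))

  -- Determinants over lists of rows and columns

  -- The alternating sum, over the positions of the list, of t at the entry times G at the list
  -- without that entry. Entries that are kept move into the continuation G, which makes both the
  -- deletion and the sign structural.
  altsum : {X : Set} → (X → Carrier) → (List X → Carrier) → List X → Carrier
  altsum t G []       = 0#
  altsum t G (x ∷ xs) = t x * G xs - altsum t (λ ys → G (x ∷ ys)) xs

  -- The determinant of the array (t x), as an iterated expansion along its
  -- rows t.
  Det : {X : Set} → List (X → Carrier) → List X → Carrier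
  Det []       []      = 1#
  Det []       (_ ∷ _) = 0#
  Det (t ∷ ts) xs      = altsum t (Det ts) xs

  module _ {X : Set} where

    altsum-cong-length : (t : X → Carrier) {G H : List X → Carrier} (xs : List X) →
      (∀ ys → suc (List.length ys) ≡ List.length xs → G ys ≈ H ys) → altsum t G xs ≈ altsum t H xs
    altsum-cong-length t []       e = refl
    altsum-cong-length t (x ∷ xs) e =
      +-cong (*-congˡ (e xs ≡.refl)) (-‿cong (altsum-cong-length t xs (λ ys l → e (x ∷ ys) (≡.cong suc l))))

    altsum-cong : (t : X → Carrier) {G H : List X → Carrier} (xs : List X) →
                  (∀ ys → G ys ≈ H ys) → altsum t G xs ≈ altsum t H xs
    altsum-cong t xs e = altsum-cong-length t xs (λ ys _ → e ys)

    altsum-congˡ : {s t : X → Carrier} (G : List X → Carrier) (xs : List X) →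
                   (∀ x → s x ≈ t x) → altsum s G xs ≈ altsum t G xs
    altsum-congˡ G []       e = refl
    altsum-congˡ G (x ∷ xs) e = +-cong (*-congʳ (e x)) (-‿cong (altsum-congˡ (λ ys → G (x ∷ ys)) xs e))

    altsum-0 : (t : X → Carrier) {G : List X → Carrier} (xs : List X) →
               (∀ ys → G ys ≈ 0#) → altsum t G xs ≈ 0#
    altsum-0 t []       e = refl
    altsum-0 t {G} (x ∷ xs) e = begin
      t x * G xs - altsum t (λ ys → G (x ∷ ys)) xs ≈⟨ +-cong (*-congˡ (e xs)) (-‿cong (altsum-0 t xs (λ ys → e (x ∷ ys)))) ⟩
      t x * 0# - 0#                                ≈⟨ +-congʳ (zeroʳ _) ⟩
      0# - 0#                                      ≈⟨ -‿inverseʳ 0# ⟩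
      0#                                           ∎
      where open ≈R

    altsum-+ : (t : X → Carrier) (G H : List X → Carrier) (xs : List X) →
               altsum t (λ ys → G ys + H ys) xs ≈ altsum t G xs + altsum t H xs
    altsum-+ t G H []       = sym (+-identityˡ 0#)
    altsum-+ t G H (x ∷ xs) = trans
      (+-congˡ (-‿cong (altsum-+ t (λ ys → G (x ∷ ys)) (λ ys → H (x ∷ ys)) xs)))
      (solve 5 (λ t g h a b → t :* (g :+ h) :- (a :+ b) := (t :* g :- a) :+ (t :* h :- b)) refl
        (t x) (G xs) (H xs) (altsum t (λ ys → G (x ∷ ys)) xs) (altsum t (λ ys → H (x ∷ ys)) xs))

    altsum-* : (t : X → Carrier) (c : Carrier) (G : List X → Carrier) (xs : List X) →
               altsum t (λ ys → c * G ys) xs ≈ c * altsum t G xs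
    altsum-* t c G []       = sym (zeroʳ c)
    altsum-* t c G (x ∷ xs) = trans
      (+-congˡ (-‿cong (altsum-* t c (λ ys → G (x ∷ ys)) xs)))
      (solve 4 (λ t c g a → t :* (c :* g) :- c :* a := c :* (t :* g :- a)) refl
        (t x) c (G xs) (altsum t (λ ys → G (x ∷ ys)) xs))

    altsum-neg : (t : X → Carrier) (G : List X → Carrier) (xs : List X) →
                 altsum t (λ ys → - G ys) xs ≈ - altsum t G xs
    altsum-neg t G xs = begin
      altsum t (λ ys → - G ys) xs         ≈⟨ altsum-cong t xs (λ ys → sym (-1*x≈-x (G ys))) ⟩
      altsum t (λ ys → - 1# * G ys) xs    ≈⟨ altsum-* t (- 1#) G xs ⟩
      - 1# * altsum t G xs                ≈⟨ -1*x≈-x _ ⟩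
      - altsum t G xs                     ∎
      where open ≈R

    altsum-*- : (t : X → Carrier) (c : Carrier) (G H : List X → Carrier) (xs : List X) →
                altsum t (λ ys → c * G ys - H ys) xs ≈ c * altsum t G xs - altsum t H xs
    altsum-*- t c G H xs = trans (altsum-+ t (λ ys → c * G ys) (λ ys → - H ys) xs)
      (+-cong (altsum-* t c G xs) (altsum-neg t H xs))

    -- The terms in which one of the two expansions takes out x cancel in pairs and leave the same
    -- kind of sum over the tail. Deriving this from `altsum-anticommute` would show only that the
    -- sum equals its own negative.
    altsum-self : (t : X → Carrier) (G : List X → Carrier) (xs : List X) → altsum t (altsum t G) xs ≈ 0#
    altsum-self t G []       = refl
    altsum-self t G (x ∷ xs) = begin
      a - altsum t (λ ys → t x * G ys - altsum t (λ zs → G (x ∷ zs)) ys) xs ≈⟨ +-congˡ (-‿cong (altsum-*- t (t x) G _ xs)) ⟩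
      a - (a - altsum t (altsum t (λ zs → G (x ∷ zs))) xs)                  ≈⟨ +-congˡ (-‿cong (+-congˡ (-‿cong (altsum-self t _ xs)))) ⟩
      a - (a - 0#)                                                          ≈⟨ +-congˡ (-‿cong (trans (+-congˡ -0#≈0#) (+-identityʳ a))) ⟩
      a - a                                                                 ≈⟨ -‿inverseʳ a ⟩
      0#                                                                    ∎
      where
      open ≈R
      a = t x * altsum t G xs

    altsum-anticommute : (s t : X → Carrier) (G : List X → Carrier) (xs : List X) →
                         altsum s (altsum t G) xs ≈ - altsum t (altsum s G) xs
    altsum-anticommute s t G []       = sym -0#≈0#
    altsum-anticommute s t G (x ∷ xs) = begin
      s x * b - altsum s (λ ys → t x * G ys - altsum t Gₓ ys) xs   ≈⟨ +-congˡ (-‿cong (altsum-*- s (t x) G (altsum t Gₓ) xs)) ⟩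
      s x * b - (t x * a - altsum s (altsum t Gₓ) xs)              ≈⟨ +-congˡ (-‿cong (+-congˡ (-‿cong (altsum-anticommute s t Gₓ xs)))) ⟩
      s x * b - (t x * a - - c)                                    ≈⟨ solve 5 (λ s t a b c → s :* b :- (t :* a :- :- c) := :- (t :* a :- (s :* b :- c))) refl (s x) (t x) a b c ⟩
      - (t x * a - (s x * b - c))                                  ≈⟨ -‿cong (+-congˡ (-‿cong (altsum-*- t (s x) G (altsum s Gₓ) xs))) ⟨
      - (t x * a - altsum t (λ ys → s x * G ys - altsum s Gₓ ys) xs) ∎
      where
      open ≈R
      Gₓ = λ ys → G (x ∷ ys)
      a = altsum s G xs
      b = altsum t G xs
      c = altsum t (altsum s Gₓ) xs

    -- Anticommutation carries t past the rows above its copy until the two are adjacent.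
    Det-repeated-row : ∀ {d} (t : X → Carrier) (A : Fin d → X → Carrier) (i : Fin d) (xs : List X) →
                     (∀ x → t x ≈ A i x) → Det (t ∷ tabulate A) xs ≈ 0#
    Det-repeated-row t A zero    xs e = trans (altsum-congˡ _ xs e) (altsum-self (A zero) _ xs)
    Det-repeated-row t A (suc i) xs e = begin
      altsum t (altsum (A zero) (Det (tabulate (A ∘ suc)))) xs     ≈⟨ altsum-anticommute t (A zero) _ xs ⟩
      - altsum (A zero) (Det (t ∷ tabulate (A ∘ suc))) xs          ≈⟨ -‿cong (altsum-0 (A zero) xs (λ ys → Det-repeated-row t (A ∘ suc) i ys e)) ⟩
      - 0#                                                       ≈⟨ -0#≈0# ⟩
      0#                                                         ∎
      where open ≈R

    -- The bridge from structural deletion in `altsum` to deletion by `punchIn` in `det`.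
    altsum-tabulate : ∀ {d} (t : X → Carrier) (G : List X → Carrier) (f : Fin (suc d) → X) →
      altsum t G (tabulate f) ≈ sum (λ j → (- 1#) ^ toℕ j * t (f j) * G (tabulate (f ∘ punchIn j)))
    altsum-tabulate {zero}  t G f = +-cong (*-congʳ (sym (*-identityˡ _))) -0#≈0#
    altsum-tabulate {suc d} t G f = begin
      t (f zero) * g - altsum t Gf (tabulate (f ∘ suc))
        ≈⟨ +-congˡ (-‿cong (altsum-tabulate t Gf (f ∘ suc))) ⟩
      t (f zero) * g - sum h
        ≈⟨ +-cong (*-congʳ (sym (*-identityˡ _))) (trans (sym (-1*x≈-x _)) (*-distribˡ-sum (- 1#) h)) ⟩
      1# * t (f zero) * g + sum (λ j → - 1# * h j)
        ≈⟨ +-congˡ (sum-cong-≋ (λ j → solve 4 (λ m p a b → m :* (p :* a :* b) := m :* p :* a :* b) refl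
             (- 1#) ((- 1#) ^ toℕ j) (t (f (suc j))) (Gf (tabulate (f ∘ suc ∘ punchIn j))))) ⟩
      sum (λ j → (- 1#) ^ toℕ j * t (f j) * G (tabulate (f ∘ punchIn j))) ∎
      where
      open ≈R
      g  = G (tabulate (f ∘ suc))
      Gf = λ ys → G (f zero ∷ ys)
      h : Fin (suc d) → Carrier
      h j = (- 1#) ^ toℕ j * t (f (suc j)) * Gf (tabulate (f ∘ suc ∘ punchIn j))

  module _ {X : Set} where

    -- The two expansions delete from different lists, so they commute without the sign that arises
    -- when both draw from one list.
    altsum-exchange : {Y : Set} (t : X → Carrier) (u : Y → Carrier) (K : List Y → List X → Carrier)
      (ys : List Y) (xs : List X) →
      altsum t (λ R → altsum u (λ S → K S R) ys) xs ≈ altsum u (λ S → altsum t (K S) xs) ys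
    altsum-exchange t u K []       xs = altsum-0 t xs (λ _ → refl)
    altsum-exchange t u K (y ∷ ys) xs = trans
      (altsum-*- t (u y) (K ys) (λ R → altsum u (λ S → K (y ∷ S) R) ys) xs)
      (+-congˡ (-‿cong (altsum-exchange t u (λ S → K (y ∷ S)) ys xs)))

    -- Expansion along the first column is again an `altsum`, now over the rows and weighted by
    -- evaluation at x. Its first term is also the first term of the row expansion; the remaining
    -- ones agree by induction and an exchange of the two sums.
    Det-column : (ts : List (X → Carrier)) (x : X) (xs : List X) →
               Det ts (x ∷ xs) ≈ altsum (λ t → t x) (λ S → Det S xs) ts
    Det-column []       x xs = refl
    Det-column (t ∷ ts) x xs = +-congˡ (-‿cong (trans
      (altsum-cong t xs (λ ys → Det-column ts x ys))
      (altsum-exchange t (λ t → t x) Det ts xs)))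

    altsum-++ : (t : X → Carrier) (G : List X → Carrier) (xs ys : List X) →
      altsum t G (xs ++ ys) ≈
      altsum t (λ zs → G (zs ++ ys)) xs + (- 1#) ^ List.length xs * altsum t (λ zs → G (xs ++ zs)) ys
    altsum-++ t G []       ys = sym (trans (+-identityˡ _) (*-identityˡ _))
    altsum-++ t G (x ∷ xs) ys = begin
      t x * G (xs ++ ys) - altsum t (λ zs → G (x ∷ zs)) (xs ++ ys) ≈⟨ +-congˡ (-‿cong (altsum-++ t (λ zs → G (x ∷ zs)) xs ys)) ⟩
      t x * G (xs ++ ys) - (a + p * b)                             ≈⟨ solve 4 (λ g a p b → g :- (a :+ p :* b) := g :- a :+ :- (p :* b)) refl (t x * G (xs ++ ys)) a p b ⟩
      t x * G (xs ++ ys) - a - p * b                               ≈⟨ +-congˡ (trans (sym (-1*x≈-x _)) (sym (*-assoc _ p b))) ⟩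
      t x * G (xs ++ ys) - a + - 1# * p * b                        ∎
      where
      open ≈R
      a = altsum t (λ zs → G (x ∷ zs ++ ys)) xs
      b = altsum t (λ zs → G (x ∷ xs ++ zs)) ys
      p = (- 1#) ^ List.length xs

  det≈Det : ∀ {d} {X : Set} (A : Fin d → X → Carrier) (e : Fin d → X) →
          det (λ r c → A r (e c)) ≈ Det (tabulate A) (tabulate e)
  det≈Det {zero}  A e = refl
  det≈Det {suc d} A e = trans
    (sum-cong-≋ (λ j → *-congˡ {(- 1#) ^ toℕ j * A zero (e j)} (det≈Det (A ∘ suc) (e ∘ punchIn j))))
    (sym (altsum-tabulate (A zero) (Det (tabulate (A ∘ suc))) e))

  minor≈Det : ∀ {d n} (A : Matrix d n) (I : KSubset n d) →
            minor A I ≈ Det (tabulate A) (tabulate (element (proj₁ I)))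
  minor≈Det A (I , ≡.refl) = det≈Det A (element I)

  -- Laplace expansion along the first k rows

  ∑ₛ-cong : ∀ n k {f g : KSubset n k → Carrier} → (∀ I → f I ≈ g I) → ∑ₛ n k f ≈ ∑ₛ n k g
  ∑ₛ-cong zero    zero    e = e _
  ∑ₛ-cong zero    (suc k) e = refl
  ∑ₛ-cong (suc n) zero    e = ∑ₛ-cong n zero (λ _ → e _)
  ∑ₛ-cong (suc n) (suc k) e = +-cong (∑ₛ-cong n k (λ _ → e _)) (∑ₛ-cong n (suc k) (λ _ → e _))

  *-distribˡ-∑ₛ : ∀ n k c (f : KSubset n k → Carrier) → c * ∑ₛ n k f ≈ ∑ₛ n k (λ I → c * f I)
  *-distribˡ-∑ₛ zero    zero    c f = refl
  *-distribˡ-∑ₛ zero    (suc k) c f = zeroʳ c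
  *-distribˡ-∑ₛ (suc n) zero    c f = *-distribˡ-∑ₛ n zero c _
  *-distribˡ-∑ₛ (suc n) (suc k) c f =
    trans (distribˡ c _ _) (+-cong (*-distribˡ-∑ₛ n k c _) (*-distribˡ-∑ₛ n (suc k) c _))

  altsum-∑ₛ : ∀ {X : Set} n k (t : X → Carrier) (F : List X → KSubset n k → Carrier) (xs : List X) →
    altsum t (λ ys → ∑ₛ n k (F ys)) xs ≈ ∑ₛ n k (λ I → altsum t (λ ys → F ys I) xs)
  altsum-∑ₛ zero    zero    t F xs = refl
  altsum-∑ₛ zero    (suc k) t F xs = altsum-0 t xs (λ _ → refl)
  altsum-∑ₛ (suc n) zero    t F xs = altsum-∑ₛ n zero t (λ ys (I , p) → F ys (outside Vec.∷ I , p)) xs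
  altsum-∑ₛ (suc n) (suc k) t F xs = trans
    (altsum-+ t (λ ys → ∑ₛ n k (Fᵢ ys)) (λ ys → ∑ₛ n (suc k) (Fₒ ys)) xs)
    (+-cong (altsum-∑ₛ n k t Fᵢ xs) (altsum-∑ₛ n (suc k) t Fₒ xs))
    where
    Fᵢ : _ → KSubset n k → Carrier
    Fᵢ ys (I , p) = F ys (inside Vec.∷ I , ≡.cong suc p)
    Fₒ : _ → KSubset n (suc k) → Carrier
    Fₒ ys (I , p) = F ys (outside Vec.∷ I , p)

  -- The sign of the term of I in Laplace's expansion along the first k rows;
  -- it is only meaningful for ∣ I ∣ ≡ k.
  laplaceSign : ∀ {n} → ℕ → Subset n → Carrier
  laplaceSign k Vec.[]            = 1#
  laplaceSign k (inside  Vec.∷ I) = laplaceSign (ℕ.pred k) I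
  laplaceSign k (outside Vec.∷ I) = (- 1#) ^ k * laplaceSign k I

  module _ {X : Set} where

    laplaceTerm : ∀ {n} k → List (X → Carrier) → List (X → Carrier) → (Fin n → X) → KSubset n k → Carrier
    laplaceTerm k ts us f (I , _) =
      laplaceSign k I * (Det ts (tabulate (f ∘ element I)) * Det us (tabulate (f ∘ element (∁ I))))

    -- Induction on the columns: the stacked determinant is expanded along the first one. The terms
    -- that take out a row of ts belong to the sets I containing this column. A row of us lies below
    -- the k rows of ts, whence the factor (-1)^k of `laplaceSign` for a column outside I.
    laplace : ∀ n k (ts us : List (X → Carrier)) (f : Fin n → X) → List.length ts ≡ k →
              ∑ₛ n k (laplaceTerm k ts us f) ≈ Det (ts ++ us) (tabulate f)

    private
      outside-part : ∀ n k (ts us : List (X → Carrier)) (f : Fin (suc n) → X) → List.length ts ≡ k →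
        ∑ₛ n k (λ (I , p) → laplaceTerm k ts us f (outside Vec.∷ I , p)) ≈
        (- 1#) ^ k * altsum (λ t → t (f zero)) (λ S → Det (ts ++ S) (tabulate (f ∘ suc))) us
      outside-part n k ts us f l = begin
        ∑ₛ n k (λ (I , p) → (- 1#) ^ k * laplaceSign k I * (Det ts (col I) * Det us (f zero ∷ col (∁ I))))
          ≈⟨ ∑ₛ-cong n k (λ (I , p) → trans
               (*-congˡ (*-congˡ (Det-column us (f zero) (col (∁ I)))))
               (trans (solve 4 (λ m q a b → m :* q :* (a :* b) := m :* (q :* a :* b)) refl _ _ _ _)
                 (*-congˡ (trans (sym (altsum-* ev _ (λ S → Det S (col (∁ I))) us))
                   (altsum-cong ev us (λ S → *-assoc _ _ _)))))) ⟩
        ∑ₛ n k (λ I → (- 1#) ^ k * altsum ev (λ S → laplaceTerm k ts S (f ∘ suc) I) us)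
          ≈⟨ *-distribˡ-∑ₛ n k _ _ ⟨
        (- 1#) ^ k * ∑ₛ n k (λ I → altsum ev (λ S → laplaceTerm k ts S (f ∘ suc) I) us)
          ≈⟨ *-congˡ (altsum-∑ₛ n k ev (λ S → laplaceTerm k ts S (f ∘ suc)) us) ⟨
        (- 1#) ^ k * altsum ev (λ S → ∑ₛ n k (laplaceTerm k ts S (f ∘ suc))) us
          ≈⟨ *-congˡ (altsum-cong ev us (λ S → laplace n k ts S (f ∘ suc) l)) ⟩
        (- 1#) ^ k * altsum ev (λ S → Det (ts ++ S) (tabulate (f ∘ suc))) us ∎
        where
        open ≈R
        ev : (X → Carrier) → Carrier
        ev t = t (f zero)
        col : (I : Subset n) → List X
        col I = tabulate (f ∘ suc ∘ element I)

      inside-part : ∀ n k (ts us : List (X → Carrier)) (f : Fin (suc n) → X) → List.length ts ≡ suc k →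
        ∑ₛ n k (λ (I , p) → laplaceTerm (suc k) ts us f (inside Vec.∷ I , ≡.cong suc p)) ≈
        altsum (λ t → t (f zero)) (λ S → Det (S ++ us) (tabulate (f ∘ suc))) ts
      inside-part n k ts us f l = begin
        ∑ₛ n k (λ (I , p) → laplaceSign k I * (Det ts (f zero ∷ col I) * Det us (col (∁ I))))
          ≈⟨ ∑ₛ-cong n k (λ (I , p) → trans
               (*-congˡ (*-congʳ (Det-column ts (f zero) (col I))))
               (trans (solve 3 (λ q a b → q :* (a :* b) := q :* b :* a) refl _ _ _)
                 (trans (sym (altsum-* ev _ (λ S → Det S (col I)) ts))
                   (altsum-cong ev ts (λ S → solve 3 (λ q a b → q :* b :* a := q :* (a :* b)) refl _ _ _))))) ⟩
        ∑ₛ n k (λ I → altsum ev (λ S → laplaceTerm k S us (f ∘ suc) I) ts)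
          ≈⟨ altsum-∑ₛ n k ev (λ S → laplaceTerm k S us (f ∘ suc)) ts ⟨
        altsum ev (λ S → ∑ₛ n k (laplaceTerm k S us (f ∘ suc))) ts
          ≈⟨ altsum-cong-length ev ts (λ S lS → laplace n k S us (f ∘ suc) (ℕₚ.suc-injective (≡.trans lS l))) ⟩
        altsum ev (λ S → Det (S ++ us) (tabulate (f ∘ suc))) ts ∎
        where
        open ≈R
        ev : (X → Carrier) → Carrier
        ev t = t (f zero)
        col : (I : Subset n) → List X
        col I = tabulate (f ∘ suc ∘ element I)

    laplace zero    zero    []       us f l = trans (*-identityˡ _) (*-identityˡ _)
    laplace zero    (suc k) (t ∷ ts) us f l = refl
    laplace (suc n) zero    []       us f l = trans (outside-part n zero [] us f l)
      (trans (*-identityˡ _) (sym (Det-column us (f zero) _)))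
    laplace (suc n) (suc k) ts       us f l = begin
      _ ≈⟨ +-cong (inside-part n k ts us f l) (outside-part n (suc k) ts us f l) ⟩
      altsum ev (λ S → Det (S ++ us) xs) ts + (- 1#) ^ suc k * altsum ev (λ S → Det (ts ++ S) xs) us
        ≡⟨ ≡.cong (λ l → altsum ev (λ S → Det (S ++ us) xs) ts + (- 1#) ^ l * altsum ev (λ S → Det (ts ++ S) xs) us) l ⟨
      altsum ev (λ S → Det (S ++ us) xs) ts + (- 1#) ^ List.length ts * altsum ev (λ S → Det (ts ++ S) xs) us
        ≈⟨ altsum-++ ev (λ S → Det S xs) ts us ⟨
      altsum ev (λ S → Det S xs) (ts ++ us) ≈⟨ Det-column (ts ++ us) (f zero) xs ⟨
      Det (ts ++ us) (tabulate f) ∎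
      where
      open ≈R
      ev : (X → Carrier) → Carrier
      ev t = t (f zero)
      xs = tabulate (f ∘ suc)

  -- Linear algebra

  -- Division-free Gaussian elimination on the first column. With pivot a in row p, every other row
  -- is multiplied by a and reduced by a multiple of row p. A dependency μ of the reduced rows lifts
  -- to a ⊙ μ, and the coefficient - s at p is what clears the first column.
  leftKernel : ∀ e d → e < d → (A : Matrix d e) →
               ∃ λ c → (∃ λ p → c p ≉ 0#) × combination c A ≋ 𝟎
  leftKernel zero    (suc d) _ A = const 1# , (zero , 0≉1 ∘ sym) , λ ()
  leftKernel (suc e) (suc d) (s≤s e<d) A with decide₀ (∃ λ p → A p zero ≉ 0#)
  ... | no ¬p =
    let c , c≉0 , cA≋0 = leftKernel e (suc d) (ℕₚ.m<n⇒m<1+n e<d) (λ i j → A i (suc j))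
    in c , c≉0 , λ where
      zero    → sum-zero (λ i → trans (*-congˡ (¬¬-elim (λ a≉0 → ¬p (i , a≉0)))) (zeroʳ (c i)))
      (suc j) → cA≋0 j
  ... | yes (p , a≉0) = c , (punchIn p q , λ e → *-≉0 a≉0 μq≉0 (trans (reflexive (≡.sym (Fₚ.insertAt-punchIn _ p _ q))) e)) , λ j → begin
      sum (λ i → c i * A i j)
        ≈⟨ sum-remove {i = p} (λ i → c i * A i j) ⟩
      c p * A p j + sum (λ i → c (punchIn p i) * A (punchIn p i) j)
        ≈⟨ +-cong (*-congʳ (reflexive (Fₚ.insertAt-lookup _ p _)))
                  (sum-cong-≋ (λ i → *-congʳ (reflexive (Fₚ.insertAt-punchIn (a ⊙ μ) p _ i)))) ⟩
      - 1# * s * A p j + sum (λ i → a * μ i * A (punchIn p i) j)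
        ≈⟨ +-congʳ (trans (solve 3 (λ m s x → m :* s :* x := (m :* x) :* s) refl (- 1#) s (A p j))
                          (*-distribˡ-sum (- 1# * A p j) (λ i → μ i * A (punchIn p i) zero))) ⟩
      sum (λ i → - 1# * A p j * (μ i * A (punchIn p i) zero)) + sum (λ i → a * μ i * A (punchIn p i) j)
        ≈⟨ ∑-distrib-+ (λ i → - 1# * A p j * (μ i * A (punchIn p i) zero)) (λ i → a * μ i * A (punchIn p i) j) ⟨
      sum (λ i → - 1# * A p j * (μ i * A (punchIn p i) zero) + a * μ i * A (punchIn p i) j)
        ≈⟨ sum-cong-≋ (λ i → trans
             (+-congʳ (*-congʳ (-1*x≈-x (A p j))))
             (solve 5 (λ x u z a y → (:- x) :* (u :* z) :+ a :* u :* y := u :* (a :* y :- z :* x)) refl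
               (A p j) (μ i) (A (punchIn p i) zero) a (A (punchIn p i) j))) ⟩
      sum (λ i → μ i * (a * A (punchIn p i) j - A (punchIn p i) zero * A p j))
        ≈⟨ cleared j ⟩
      0# ∎
    where
    open ≈R
    a = A p zero
    B : Matrix d e
    B i j = a * A (punchIn p i) (suc j) - A (punchIn p i) zero * A p (suc j)
    IH = leftKernel e d e<d B
    μ = proj₁ IH
    q = proj₁ (proj₁ (proj₂ IH))
    μq≉0 = proj₂ (proj₁ (proj₂ IH))
    s = sum (λ i → μ i * A (punchIn p i) zero)
    c = F.insertAt (a ⊙ μ) p (- 1# * s)
    cleared : ∀ j → sum (λ i → μ i * (a * A (punchIn p i) j - A (punchIn p i) zero * A p j)) ≈ 0#
    cleared zero    = sum-zero (λ i → trans
      (*-congˡ (trans (+-congʳ (*-comm a _)) (-‿inverseʳ _))) (zeroʳ (μ i)))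
    cleared (suc j) = proj₂ (proj₂ IH) j

  -- Subspaces, independence and extension of bases

  record IsSubspace {n} (W : Pred (ℝ^ n) 0ℓ) : Set where
    field
      ∋-resp : ∀ {u v} → u ≋ v → W u → W v
      ∋-𝟎    : W 𝟎
      ∋-⊕    : ∀ {u v} → W u → W v → W (u ⊕ v)
      ∋-⊙    : ∀ c {v} → W v → W (c ⊙ v)

    ∋-⊖ : ∀ {u v} → W u → W v → W (u ⊖ v)
    ∋-⊖ {u} {v} Wu Wv = ∋-resp (λ i → sym (⊖≋⊕ u v i)) (∋-⊕ Wu (∋-⊙ (- 1#) Wv))

    -- Membership is asked only of rows with nonzero coefficient, so that the lemma applies to
    -- `SpanOf`, where coefficients vanish off the index set.
    ∋-combination : ∀ {d} (c : ℝ^ d) (A : Matrix d n) → (∀ i → c i ≉ 0# → W (A i)) → W (combination c A)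
    ∋-combination {zero}  c A WA = ∋-𝟎
    ∋-combination {suc d} c A WA = ∋-⊕ head∈ (∋-combination (c ∘ suc) (A ∘ suc) (WA ∘ suc))
      where
      head∈ : W (c zero ⊙ A zero)
      head∈ with c zero ≈? 0#
      ... | yes c≈0 = ∋-resp (λ j → sym (trans (*-congʳ c≈0) (zeroˡ _))) ∋-𝟎
      ... | no  c≉0 = ∋-⊙ (c zero) (WA zero c≉0)

    RowSpace⊆ : ∀ {d} (A : Matrix d n) → (∀ i → W (A i)) → RowSpace A ⊆ W
    RowSpace⊆ A WA (c , v≋) = ∋-resp (λ j → sym (v≋ j)) (∋-combination c A (λ i _ → WA i))

  open IsSubspace

  ≋-sym : ∀ {n} {u v : ℝ^ n} → u ≋ v → v ≋ u
  ≋-sym e j = sym (e j)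

  ≋-trans : ∀ {n} {u v w : ℝ^ n} → u ≋ v → v ≋ w → u ≋ w
  ≋-trans e f j = trans (e j) (f j)

  rowSpace-isSubspace : ∀ {d n} (A : Matrix d n) → IsSubspace (RowSpace A)
  rowSpace-isSubspace A = record
    { ∋-resp = λ u≋v (c , e) → c , ≋-trans (≋-sym u≋v) e
    ; ∋-𝟎    = 𝟎 , ≋-sym (combination-𝟎 A)
    ; ∋-⊕    = λ (c , e) (c′ , e′) → c ⊕ c′ , λ j → trans (+-cong (e j) (e′ j)) (sym (combination-⊕ c c′ A j))
    ; ∋-⊙    = λ s (c , e) → s ⊙ c , λ j → trans (*-congˡ (e j)) (sym (combination-⊙ s c A j))
    }

  isSubspace-≐ : ∀ {n} {W W′ : Pred (ℝ^ n) 0ℓ} → W ≐ W′ → IsSubspace W′ → IsSubspace W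
  isSubspace-≐ (W⊆ , ⊆W) S = record
    { ∋-resp = λ e → ⊆W ∘ ∋-resp S e ∘ W⊆
    ; ∋-𝟎    = ⊆W (∋-𝟎 S)
    ; ∋-⊕    = λ u v → ⊆W (∋-⊕ S (W⊆ u) (W⊆ v))
    ; ∋-⊙    = λ c → ⊆W ∘ ∋-⊙ S c ∘ W⊆
    }

  ∩-isSubspace : ∀ {n} {W W′ : Pred (ℝ^ n) 0ℓ} → IsSubspace W → IsSubspace W′ → IsSubspace (W ∩ W′)
  ∩-isSubspace S S′ = record
    { ∋-resp = λ e (u , u′) → ∋-resp S e u , ∋-resp S′ e u′
    ; ∋-𝟎    = ∋-𝟎 S , ∋-𝟎 S′
    ; ∋-⊕    = λ (u , u′) (v , v′) → ∋-⊕ S u v , ∋-⊕ S′ u′ v′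
    ; ∋-⊙    = λ c (u , u′) → ∋-⊙ S c u , ∋-⊙ S′ c u′
    }

  unit : ∀ {d} → Fin d → ℝ^ d
  unit zero    zero    = 1#
  unit zero    (suc j) = 0#
  unit (suc i) zero    = 0#
  unit (suc i) (suc j) = unit i j

  combination-unit : ∀ {d n} (i : Fin d) (A : Matrix d n) → combination (unit i) A ≋ A i
  combination-unit zero    A j = trans (+-cong (*-identityˡ _) (combination-𝟎 (A ∘ suc) j)) (+-identityʳ _)
  combination-unit (suc i) A j = trans (+-cong (zeroˡ _) (combination-unit i (A ∘ suc) j)) (+-identityˡ _)

  combination-of-units : ∀ {n} (c : ℝ^ n) → combination c unit ≋ c
  combination-of-units c zero    = trans
    (+-cong (*-identityʳ _) (sum-zero (λ i → zeroʳ (c (suc i))))) (+-identityʳ _)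
  combination-of-units c (suc j) = trans
    (+-cong (zeroʳ _) (combination-of-units (c ∘ suc) j)) (+-identityˡ _)

  row∈RowSpace : ∀ {d n} (A : Matrix d n) i → RowSpace A (A i)
  row∈RowSpace A i = unit i , ≋-sym (combination-unit i A)

  combination-assoc : ∀ {d e n} (c : ℝ^ d) (C : Matrix d e) (B : Matrix e n) →
    combination c (λ i → combination (C i) B) ≋ combination (combination c C) B
  combination-assoc {d} {e} c C B k = begin
    sum (λ i → c i * sum (λ j → C i j * B j k))    ≈⟨ sum-cong-≋ (λ i → *-distribˡ-sum (c i) (λ j → C i j * B j k)) ⟩
    sum (λ i → sum (λ j → c i * (C i j * B j k)))  ≈⟨ ∑-comm (λ i j → c i * (C i j * B j k)) ⟩
    sum (λ j → sum (λ i → c i * (C i j * B j k)))  ≈⟨ sum-cong-≋ (λ j → trans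
                                                        (sum-cong-≋ (λ i → sym (*-assoc (c i) (C i j) (B j k))))
                                                        (sym (*-distribʳ-sum (B j k) (λ i → c i * C i j)))) ⟩
    sum (λ j → sum (λ i → c i * C i j) * B j k)    ∎
    where open ≈R

  -- The matrix A factors as C times B with C of size d × e. If e < d, a vector in the left kernel
  -- of C is a dependency of A.
  independent-≤ : ∀ {d e n} (A : Matrix d n) (B : Matrix e n) →
                  LinearlyIndependent A → (∀ i → RowSpace B (A i)) → d ℕ.≤ e
  independent-≤ {d} {e} A B indep A⊆B with d ℕₚ.≤? e
  ... | yes d≤e = d≤e
  ... | no  d≰e =
    let C = proj₁ ∘ A⊆B
        c , (p , cp≉0) , cC≋0 = leftKernel e d (ℕₚ.≰⇒> d≰e) C
    in contradiction (indep c (λ k → begin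
         combination c A k                              ≈⟨ combination-congʳ c (proj₂ ∘ A⊆B) k ⟩
         combination c (λ i → combination (C i) B) k    ≈⟨ combination-assoc c C B k ⟩
         combination (combination c C) B k              ≈⟨ combination-cong B cC≋0 k ⟩
         combination 𝟎 B k                              ≈⟨ combination-𝟎 B k ⟩
         0#                                             ∎) p) cp≉0
    where open ≈R

  independent-≤-ambient : ∀ {d n} (A : Matrix d n) → LinearlyIndependent A → d ℕ.≤ n
  independent-≤-ambient A indep = independent-≤ A unit indep (λ i → A i , ≋-sym (combination-of-units (A i)))

  independent-∷ : ∀ {d n} (w : ℝ^ n) (A : Matrix d n) →
                  LinearlyIndependent A → ¬ RowSpace A w → LinearlyIndependent (w F.∷ A)
  independent-∷ w A indep w∉A c cA≋0 = all-zero
    where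
    open ≈R
    c₀≈0 : c zero ≈ 0#
    c₀≈0 with c zero ≈? 0#
    ... | yes c₀≈0 = c₀≈0
    ... | no  c₀≉0 =
      let y , c₀y≈1 = inverse (c zero) c₀≉0
      in contradiction (- y ⊙ (c ∘ suc) , λ j → begin
           w j                                                       ≈⟨ *-identityˡ _ ⟨
           1# * w j                                                  ≈⟨ *-congʳ c₀y≈1 ⟨
           c zero * y * w j                                          ≈⟨ solve 4 (λ c y w s → c :* y :* w := y :* (c :* w :+ s) :+ (:- y) :* s) refl (c zero) y (w j) _ ⟩
           y * (c zero * w j + combination (c ∘ suc) A j) + - y * combination (c ∘ suc) A j
             ≈⟨ +-congʳ (trans (*-congˡ (cA≋0 j)) (zeroʳ y)) ⟩
           0# + - y * combination (c ∘ suc) A j                      ≈⟨ +-identityˡ _ ⟩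
           - y * combination (c ∘ suc) A j                           ≈⟨ combination-⊙ (- y) (c ∘ suc) A j ⟨
           combination (- y ⊙ (c ∘ suc)) A j                         ∎) w∉A
    all-zero : ∀ i → c i ≈ 0#
    all-zero zero    = c₀≈0
    all-zero (suc i) = indep (c ∘ suc) (λ j → begin
      combination (c ∘ suc) A j                   ≈⟨ +-identityˡ _ ⟨
      0# + combination (c ∘ suc) A j              ≈⟨ +-congʳ (trans (*-congʳ c₀≈0) (zeroˡ _)) ⟨
      c zero * w j + combination (c ∘ suc) A j    ≈⟨ cA≋0 j ⟩
      0#                                          ∎) i

  independent-cong : ∀ {d n} (A B : Matrix d n) → (∀ i → A i ≋ B i) →
                     LinearlyIndependent A → LinearlyIndependent B
  independent-cong A B A≋B indep c cB≋0 = indep c (≋-trans (combination-congʳ c A≋B) cB≋0)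

  sum-split : ∀ e {d} (f : Vector Carrier (e ℕ.+ d)) → sum f ≈ sum (f ∘ (_↑ˡ d)) + sum (f ∘ (e ↑ʳ_))
  sum-split zero    f = sym (+-identityˡ _)
  sum-split (suc e) f = trans (+-congˡ (sum-split e (f ∘ suc))) (sym (+-assoc _ _ _))

  combination-split : ∀ {e d n} (c : ℝ^ (e ℕ.+ d)) (E : Matrix e n) (A : Matrix d n) →
    combination c (E F.++ A) ≋ combination (c ∘ (_↑ˡ d)) E ⊕ combination (c ∘ (e ↑ʳ_)) A
  combination-split {e} {d} c E A j = trans (sum-split e (λ i → c i * (E F.++ A) i j)) (+-cong
    (sum-cong-≋ (λ i → *-congˡ {c (i ↑ˡ d)} (reflexive (≡.cong (λ v → v j) (Fₚ.lookup-++ˡ E A i)))))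
    (sum-cong-≋ (λ i → *-congˡ {c (e ↑ʳ i)} (reflexive (≡.cong (λ v → v j) (Fₚ.lookup-++ʳ E A i))))))

  combination-++ : ∀ {e d n} (c : ℝ^ e) (c′ : ℝ^ d) (E : Matrix e n) (A : Matrix d n) →
    combination (c F.++ c′) (E F.++ A) ≋ combination c E ⊕ combination c′ A
  combination-++ c c′ E A = ≋-trans (combination-split (c F.++ c′) E A) (λ j → +-cong
    (combination-cong E (λ i → reflexive (Fₚ.lookup-++ˡ c c′ i)) j)
    (combination-cong A (λ i → reflexive (Fₚ.lookup-++ʳ c c′ i)) j))

  all-++ : ∀ {V : Set} {e d} (P : Pred V 0ℓ) (E : Vector V e) (A : Vector V d) →
           (∀ i → P (E i)) → (∀ i → P (A i)) → ∀ i → P ((E F.++ A) i)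
  all-++ {e = e} P E A PE PA i with splitAt e i
  ... | inj₁ i′ = PE i′
  ... | inj₂ i′ = PA i′

  rowSpace-++ : ∀ {e d n} (E : Matrix e n) (A : Matrix d n) {u v : ℝ^ n} →
                RowSpace E u → RowSpace A v → RowSpace (E F.++ A) (u ⊕ v)
  rowSpace-++ E A (c , u≋) (c′ , v≋) =
    c F.++ c′ , λ j → trans (+-cong (u≋ j) (v≋ j)) (sym (combination-++ c c′ E A j))

  rowSpace-++ˡ : ∀ {e d n} (E : Matrix e n) (A : Matrix d n) → RowSpace E ⊆ RowSpace (E F.++ A)
  rowSpace-++ˡ E A u∈E = ∋-resp (rowSpace-isSubspace (E F.++ A)) (λ j → +-identityʳ _)
    (rowSpace-++ E A u∈E (∋-𝟎 (rowSpace-isSubspace A)))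

  rowSpace-++ʳ : ∀ {e d n} (E : Matrix e n) (A : Matrix d n) → RowSpace A ⊆ RowSpace (E F.++ A)
  rowSpace-++ʳ E A v∈A = ∋-resp (rowSpace-isSubspace (E F.++ A)) (λ j → +-identityˡ _)
    (rowSpace-++ E A (∋-𝟎 (rowSpace-isSubspace E)) v∈A)

  ⊕-zero⇒≋ : ∀ {n} (u v : ℝ^ n) → u ⊕ v ≋ 𝟎 → u ≋ (- 1#) ⊙ v
  ⊕-zero⇒≋ u v e j = trans (+-inverseˡ-unique _ _ (e j)) (sym (-1*x≈-x _))

  ↑-cases : ∀ e {d} {P : Pred (Fin (e ℕ.+ d)) 0ℓ} →
            (∀ i → P (i ↑ˡ d)) → (∀ i → P (e ↑ʳ i)) → ∀ i → P i
  ↑-cases zero    l r i       = r i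
  ↑-cases (suc e) l r zero    = l zero
  ↑-cases (suc e) l r (suc i) = ↑-cases e (l ∘ suc) r i

  independent-++ : ∀ {e d n} (E : Matrix e n) (A : Matrix d n) →
    LinearlyIndependent E → LinearlyIndependent A →
    (∀ {v} → RowSpace E v → RowSpace A v → v ≋ 𝟎) → LinearlyIndependent (E F.++ A)
  independent-++ {e} {d} E A indepE indepA trivial c c≋0 =
    ↑-cases e (indepE (c ∘ (_↑ˡ d)) u≋0) (indepA (c ∘ (e ↑ʳ_)) v≋0)
    where
    u = combination (c ∘ (_↑ˡ d)) E
    v = combination (c ∘ (e ↑ʳ_)) A
    u+v≋0 : u ⊕ v ≋ 𝟎
    u+v≋0 = ≋-trans (≋-sym (combination-split c E A)) c≋0
    u≋0 : u ≋ 𝟎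
    u≋0 = trivial (c ∘ (_↑ˡ d) , λ _ → refl)
      (∋-resp (rowSpace-isSubspace A) (≋-sym (⊕-zero⇒≋ u v u+v≋0))
        (∋-⊙ (rowSpace-isSubspace A) (- 1#) (c ∘ (e ↑ʳ_) , λ _ → refl)))
    v≋0 : v ≋ 𝟎
    v≋0 j = trans (sym (+-identityˡ _)) (trans (+-congʳ (sym (u≋0 j))) (u+v≋0 j))

  independent-++⇒trivial : ∀ {e d n} (E : Matrix e n) (A : Matrix d n) →
    LinearlyIndependent (E F.++ A) → ∀ {v} → RowSpace E v → RowSpace A v → v ≋ 𝟎
  independent-++⇒trivial {e} {d} E A indep {v} (c , v≋cE) (c′ , v≋c′A) =
    ≋-trans v≋cE (≋-trans (combination-cong E c≋0) (combination-𝟎 E))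
    where
    open ≈R
    c≋0 : c ≋ 𝟎
    c≋0 i = trans (reflexive (≡.sym (Fₚ.lookup-++ˡ c ((- 1#) ⊙ c′) i)))
      (indep (c F.++ (- 1#) ⊙ c′) (λ j → begin
        combination (c F.++ (- 1#) ⊙ c′) (E F.++ A) j          ≈⟨ combination-++ c _ E A j ⟩
        combination c E j + combination ((- 1#) ⊙ c′) A j      ≈⟨ +-cong (sym (v≋cE j)) (trans (combination-⊙ (- 1#) c′ A j) (trans (-1*x≈-x _) (-‿cong (sym (v≋c′A j))))) ⟩
        v j - v j                                              ≈⟨ -‿inverseʳ _ ⟩
        0#                                                     ∎) (i ↑ˡ d))

  Extension : ∀ {d n} → Matrix d n → Pred (ℝ^ n) 0ℓ → Set
  Extension {d} {n} A G = ∃ λ e → ∃ λ (E : Matrix e n) →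
    (∀ i → G (E i)) × LinearlyIndependent (E F.++ A) × G ⊆ RowSpace (E F.++ A)

  abstract
    -- The set G need not be a subspace, and the new rows are members of G itself; this is how bases
    -- are later picked from among the projected normals. Rows outside the current span are added
    -- while there are any. The fuel covers the rows still missing to n, beyond which no family is
    -- independent.
    extend : ∀ {d n} (A : Matrix d n) → LinearlyIndependent A → (G : Pred (ℝ^ n) 0ℓ) →
      Extension A G
    extend {d} {n} A indepA G = go n F.[] (λ ()) (independent-cong A (F.[] F.++ A) (λ _ _ → refl) indepA) (ℕₚ.m≤m+n n d)
      where
      go : ∀ fuel {e} (E : Matrix e n) → (∀ i → G (E i)) → LinearlyIndependent (E F.++ A) →
           n ℕ.≤ fuel ℕ.+ (e ℕ.+ d) →
           Extension A G
      go fuel {e} E GE indep n≤ with decide₀ (∃ λ w → G w × ¬ RowSpace (E F.++ A) w)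
      ... | no ¬w = e , E , GE , indep , λ {w} Gw → ¬¬-elim (λ w∉ → ¬w (w , Gw , w∉))
      ... | yes (w , Gw , w∉) = continue fuel n≤
        where
        indep′ : LinearlyIndependent ((w F.∷ E) F.++ A)
        indep′ = independent-cong (w F.∷ (E F.++ A)) ((w F.∷ E) F.++ A)
          (λ { zero _ → refl
             ; (suc i) j → reflexive (≡.cong (λ v → v j) (++-suc i)) })
          (independent-∷ w (E F.++ A) indep w∉)
          where
          ++-suc : ∀ i → (E F.++ A) i ≡ ((w F.∷ E) F.++ A) (suc i)
          ++-suc i with splitAt e i
          ... | inj₁ _ = ≡.refl
          ... | inj₂ _ = ≡.refl
        continue : ∀ fuel → n ℕ.≤ fuel ℕ.+ (e ℕ.+ d) → Extension A G
        continue zero       n≤ = contradiction (independent-≤-ambient ((w F.∷ E) F.++ A) indep′) (ℕₚ.≤⇒≯ n≤)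
        continue (suc fuel) n≤ = go fuel (w F.∷ E) (λ { zero → Gw ; (suc i) → GE i }) indep′
          (≡.subst (n ℕ.≤_) (≡.sym (ℕₚ.+-suc fuel (e ℕ.+ d))) n≤)

  independent-[] : ∀ {n} → LinearlyIndependent {0} {n} F.[]
  independent-[] c _ ()

  -- Dimension

  hasDim-≐ : ∀ {n d} {W W′ : Pred (ℝ^ n) 0ℓ} → W ≐ W′ → HasDim W d → HasDim W′ d
  hasDim-≐ (W⊆ , ⊆W) (A , indep , W⊆A , A⊆W) = A , indep , W⊆A ∘ ⊆W , W⊆ ∘ A⊆W

  hasDim⇒isSubspace : ∀ {n d} {W : Pred (ℝ^ n) 0ℓ} → HasDim W d → IsSubspace W
  hasDim⇒isSubspace (A , _ , W≐A) = isSubspace-≐ W≐A (rowSpace-isSubspace A)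

  basis-rows : ∀ {n d} {W : Pred (ℝ^ n) 0ℓ} (A : Matrix d n) → IsBasis A W → ∀ i → W (A i)
  basis-rows A (_ , _ , A⊆W) i = A⊆W (row∈RowSpace A i)

  hasDim-mono : ∀ {n d e} {W W′ : Pred (ℝ^ n) 0ℓ} → HasDim W d → HasDim W′ e → W ⊆ W′ → d ℕ.≤ e
  hasDim-mono (A , basisA) (B , _ , W′⊆B , _) W⊆W′ =
    independent-≤ A B (proj₁ basisA) (λ i → W′⊆B (W⊆W′ (basis-rows A basisA i)))

  hasDim-unique : ∀ {n d e} {W : Pred (ℝ^ n) 0ℓ} → HasDim W d → HasDim W e → d ≡ e
  hasDim-unique D E = ℕₚ.≤-antisym (hasDim-mono D E id) (hasDim-mono E D id)

  hasDim-full : ∀ {n d} {W W′ : Pred (ℝ^ n) 0ℓ} → HasDim W d → HasDim W′ d → W ⊆ W′ → W′ ⊆ W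
  hasDim-full {W = W} {W′} (A , basisA@(indep , _ , A⊆W)) (B , _ , W′⊆B , _) W⊆W′ {v} W′v =
    ¬¬-elim (λ v∉W → ℕₚ.1+n≰n (independent-≤ (v F.∷ A) B
      (independent-∷ v A indep (v∉W ∘ A⊆W))
      λ { zero → W′⊆B W′v ; (suc i) → W′⊆B (W⊆W′ (basis-rows A basisA i)) }))

  abstract
    dimension : ∀ {n} {W : Pred (ℝ^ n) 0ℓ} → IsSubspace W → ∃ (HasDim W)
    dimension {W = W} S =
      let e , E , WE , indep , W⊆E = extend F.[] independent-[] W
      in e ℕ.+ 0 , E F.++ F.[] , indep , W⊆E , RowSpace⊆ S (E F.++ F.[]) (all-++ W E F.[] WE λ ())

  hasDim-≤-spanning : ∀ {n d e} {W : Pred (ℝ^ n) 0ℓ} → HasDim W d → (A : Matrix e n) → W ⊆ RowSpace A → d ℕ.≤ e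
  hasDim-≤-spanning (B , basisB) A W⊆A = independent-≤ B A (proj₁ basisB) (W⊆A ∘ basis-rows B basisB)

  hasDim-rowSpace : ∀ {n d} (A : Matrix d n) → LinearlyIndependent A → HasDim (RowSpace A) d
  hasDim-rowSpace A indep = A , indep , id , id

  hasDim-full-space : ∀ {n} → HasDim {n} (const ⊤) n
  hasDim-full-space = unit
    , (λ c e i → trans (sym (combination-of-units c i)) (e i))
    , (λ {v} _ → v , ≋-sym (combination-of-units v)) , _

  hasDim-trivial : ∀ {n} {W : Pred (ℝ^ n) 0ℓ} → IsSubspace W → (∀ {v} → W v → v ≋ 𝟎) → HasDim W 0
  hasDim-trivial S W⊆0 = F.[] , independent-[] , (λ Wv → F.[] , W⊆0 Wv) , RowSpace⊆ S F.[] λ ()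

  hasDim-0⇒trivial : ∀ {n} {W : Pred (ℝ^ n) 0ℓ} → HasDim W 0 → ∀ {v} → W v → v ≋ 𝟎
  hasDim-0⇒trivial (A , _ , W⊆A , _) Wv = proj₂ (W⊆A Wv)

  -- Determinants and linear independence

  cofactor : ∀ {d} → Matrix (suc d) (suc d) → ℝ^ (suc d)
  cofactor A j = (- 1#) ^ toℕ j * det (λ r c → A (suc r) (punchIn j c))

  det≈cofactor : ∀ {d} (A : Matrix (suc d) (suc d)) → det A ≈ ⟨ cofactor A , A zero ⟩
  det≈cofactor A = sum-cong-≋ (λ j → solve 3 (λ s a m → s :* a :* m := s :* m :* a) refl
    ((- 1#) ^ toℕ j) (A zero j) (det (λ r c → A (suc r) (punchIn j c))))

  -- The cofactors ignore the first row, so it may be replaced by row `suc i`, and the pairing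
  -- becomes a determinant with a repeated row.
  cofactor-⊥ : ∀ {d} (A : Matrix (suc d) (suc d)) i → ⟨ cofactor A , A (suc i) ⟩ ≈ 0#
  cofactor-⊥ A i = begin
    ⟨ cofactor A , A (suc i) ⟩         ≈⟨ det≈cofactor B ⟨
    det B                              ≈⟨ det≈Det B id ⟩
    Det (tabulate B) (tabulate id)       ≈⟨ Det-repeated-row (A (suc i)) (A ∘ suc) i (tabulate id) (λ _ → refl) ⟩
    0#                                 ∎
    where
    open ≈R
    B = A (suc i) F.∷ (A ∘ suc)

  -- Pairing the dependency with the cofactor vector kills every row but the first, which settles
  -- the case c zero ≉ 0#. Otherwise the dependency lives on the lower rows, and every minor of the
  -- expansion vanishes by induction.
  det-dependent : ∀ {d} (A : Matrix d d) (c : ℝ^ d) p → c p ≉ 0# → combination c A ≋ 𝟎 → det A ≈ 0#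
  det-dependent {suc d} A c p c≉0 cA≋0 with c zero ≈? 0#
  ... | no c₀≉0 = *-cancelˡ-zero c₀≉0 (begin
    c zero * det A                                      ≈⟨ *-congˡ (det≈cofactor A) ⟩
    c zero * ⟨ δ , A zero ⟩                             ≈⟨ +-identityʳ _ ⟨
    c zero * ⟨ δ , A zero ⟩ + 0#                        ≈⟨ +-congˡ (sum-zero (λ i → trans (*-congˡ (cofactor-⊥ A i)) (zeroʳ (c (suc i))))) ⟨
    sum (λ i → c i * ⟨ δ , A i ⟩)                       ≈⟨ ⟨⟩-combinationʳ δ c A ⟨
    ⟨ δ , combination c A ⟩                             ≈⟨ ⟨⟩-cong {u = δ} (λ _ → refl) cA≋0 ⟩
    ⟨ δ , 𝟎 ⟩                                           ≈⟨ ⟨⟩-𝟎ʳ δ ⟩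
    0#                                                  ∎)
    where
    open ≈R
    δ = cofactor A
  ... | yes c₀≈0 = sum-zero (λ j → trans (*-congˡ {(- 1#) ^ toℕ j * A zero j} (minor≈0 p c≉0 j)) (zeroʳ _))
    where
    tail≋0 : combination (c ∘ suc) (A ∘ suc) ≋ 𝟎
    tail≋0 j = trans (sym (+-identityˡ _)) (trans (+-congʳ (sym (trans (*-congʳ c₀≈0) (zeroˡ (A zero j))))) (cA≋0 j))
    minor≈0 : ∀ p → c p ≉ 0# → ∀ j → det (λ r k → A (suc r) (punchIn j k)) ≈ 0#
    minor≈0 zero    c≉0 = contradiction c₀≈0 c≉0
    minor≈0 (suc p) c≉0 j = det-dependent _ (c ∘ suc) p c≉0 (tail≋0 ∘ punchIn j)

  unit-diagonal : ∀ {d} (i : Fin d) → unit i i ≈ 1#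
  unit-diagonal zero    = refl
  unit-diagonal (suc i) = unit-diagonal i

  unit-off-diagonal : ∀ {d} (i : Fin (suc d)) j → unit i (punchIn i j) ≈ 0#
  unit-off-diagonal         zero    j       = refl
  unit-off-diagonal {suc _} (suc i) zero    = refl
  unit-off-diagonal {suc _} (suc i) (suc j) = unit-off-diagonal i j

  punchIn-cases : ∀ {d} {P : Pred (Fin (suc d)) 0ℓ} i → P i → (∀ j → P (punchIn i j)) → ∀ l → P l
  punchIn-cases {P = P} i Pi Pj l with i Finₚ.≟ l
  ... | yes ≡.refl = Pi
  ... | no  i≢l    = ≡.subst P (Finₚ.punchIn-punchOut i≢l) (Pj (punchOut i≢l))

  independent-removeColumn : ∀ {d e} (A : Matrix d (suc e)) j → LinearlyIndependent A → ¬ RowSpace A (unit j) →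
                             LinearlyIndependent (λ r k → A r (punchIn j k))
  -- A dependency of the shortened rows combines the full rows to a vector supported at j alone.
  -- Were its entry there nonzero, rescaling it would put `unit j` into the row space.
  independent-removeColumn A j indep unit∉A c cA≋0 = indep c (punchIn-cases j vⱼ≈0 cA≋0)
    where
    open ≈R
    v = combination c A
    vⱼ≈0 : v j ≈ 0#
    vⱼ≈0 = ¬¬-elim λ vⱼ≉0 →
      let y , vⱼy≈1 = inverse (v j) vⱼ≉0
      in unit∉A (∋-resp (rowSpace-isSubspace A)
           (punchIn-cases j (trans (*-comm y (v j)) (trans vⱼy≈1 (sym (unit-diagonal j))))
             (λ k → trans (*-congˡ (cA≋0 k)) (trans (zeroʳ y) (sym (unit-off-diagonal j k)))))
           (∋-⊙ (rowSpace-isSubspace A) y {v} (c , λ _ → refl)))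

  -- If the determinant vanished, the cofactor vector δ would be orthogonal to all rows; these span
  -- the whole space, so δ would be zero. But the lower rows are too few to span every unit vector,
  -- and deleting the column of a missing one leaves an independent square matrix, whose minor is
  -- nonzero by induction and is an entry of δ up to sign.
  det-independent : ∀ {d} (A : Matrix d d) → LinearlyIndependent A → det A ≉ 0#
  det-independent {zero}  A indep = 0≉1 ∘ sym
  det-independent {suc d} A indep det≈0 =
    *-≉0 (^-≉0 (toℕ j) -1≉0) (det-independent _ (independent-removeColumn (A ∘ suc) j indep-tail unit∉)) (δ≋0 j)
    where
    open ≈R
    δ = cofactor A
    δ⊥A : ∀ i → ⟨ δ , A i ⟩ ≈ 0#
    δ⊥A zero    = trans (sym (det≈cofactor A)) det≈0
    δ⊥A (suc i) = cofactor-⊥ A i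
    δ≋0 : δ ≋ 𝟎
    δ≋0 with hasDim-full (hasDim-rowSpace A indep) hasDim-full-space _ {δ} tt
    ... | c , δ≋cA = ⟨⟩-definite δ (begin
      ⟨ δ , δ ⟩                      ≈⟨ ⟨⟩-cong {u = δ} (λ _ → refl) δ≋cA ⟩
      ⟨ δ , combination c A ⟩        ≈⟨ ⟨⟩-combinationʳ δ c A ⟩
      sum (λ i → c i * ⟨ δ , A i ⟩)  ≈⟨ sum-zero (λ i → trans (*-congˡ (δ⊥A i)) (zeroʳ (c i))) ⟩
      0#                             ∎)
    indep-tail : LinearlyIndependent (A ∘ suc)
    indep-tail c c≋0 i = indep (0# F.∷ c) (λ j → trans (+-cong (zeroˡ _) (c≋0 j)) (+-identityˡ 0#)) (suc i)
    missing-unit : ∃ λ j → ¬ RowSpace (A ∘ suc) (unit j)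
    missing-unit = ¬¬-elim λ none → ℕₚ.1+n≰n (independent-≤ unit (A ∘ suc)
      (proj₁ (proj₂ hasDim-full-space)) (λ j → ¬¬-elim (λ unit∉ → none (j , unit∉))))
    j = proj₁ missing-unit
    unit∉ = proj₂ missing-unit

  tabulate-++ : ∀ {V : Set} {e d} (E : Vector V e) (A : Vector V d) →
                tabulate (E F.++ A) ≡ tabulate E ++ tabulate A
  tabulate-++ {e = zero}  E A = ≡.refl
  tabulate-++ {e = suc e} E A = ≡.cong (E zero ∷_)
    (≡.trans (Listₚ.tabulate-cong ++-suc) (tabulate-++ (E ∘ suc) A))
    where
    ++-suc : ∀ i → (E F.++ A) (suc i) ≡ ((E ∘ suc) F.++ A) i
    ++-suc i with splitAt e i
    ... | inj₁ _ = ≡.refl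
    ... | inj₂ _ = ≡.refl

  -- Phrased with lists because the stacked matrix is square only up to a propositional equality
  -- such as k + (n ∸ k) ≡ n; matching on it makes the row count definitional.
  Det-stack : ∀ {a b n} → a ℕ.+ b ≡ n → (W : Matrix a n) (X : Matrix b n) →
            (LinearlyIndependent (W F.++ X) → Det (tabulate W ++ tabulate X) (tabulate id) ≉ 0#) ×
            (¬ LinearlyIndependent (W F.++ X) → Det (tabulate W ++ tabulate X) (tabulate id) ≈ 0#)
  Det-stack ≡.refl W X rewrite ≡.sym (tabulate-++ W X) =
      (λ indep e → det-independent (W F.++ X) indep (trans (det≈Det (W F.++ X) id) e))
    , (λ dep → ¬¬-elim λ Det≉0 → dep λ c c≋0 i → ¬¬-elim λ cᵢ≉0 →
        Det≉0 (trans (sym (det≈Det (W F.++ X) id)) (det-dependent (W F.++ X) c i cᵢ≉0 c≋0)))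

  -- The adjoint form as a determinant

  foldr-+-suc : ∀ {d} (g : Fin d → ℕ) → F.foldr ℕ._+_ 0 (suc ∘ g) ≡ d ℕ.+ F.foldr ℕ._+_ 0 g
  foldr-+-suc {zero}  g = ≡.refl
  foldr-+-suc {suc d} g = ≡.cong suc (≡.trans (≡.cong (g zero ℕ.+_) (foldr-+-suc (g ∘ suc)))
    (≡.trans (≡.sym (ℕₚ.+-assoc (g zero) d s))
      (≡.trans (≡.cong (ℕ._+ s) (ℕₚ.+-comm (g zero) d)) (ℕₚ.+-assoc d (g zero) s))))
    where s = F.foldr ℕ._+_ 0 (g ∘ suc)

  -- (- 1#) ^ (k (k + 1) / 2)
  triangularSign : ℕ → Carrier
  triangularSign zero    = 1#
  triangularSign (suc k) = (- 1#) ^ suc k * triangularSign k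

  triangularSign-≉0 : ∀ k → triangularSign k ≉ 0#
  triangularSign-≉0 zero    = 0≉1 ∘ sym
  triangularSign-≉0 (suc k) = *-≉0 (^-≉0 (suc k) -1≉0) (triangularSign-≉0 k)

  -- Prepending an entry shifts every element of I by one and so contributes (-1)^∣I∣. For an
  -- outside entry this is the new factor of `laplaceSign`; for an inside entry it joins the sign of
  -- the new element 1 to form the new factor of `triangularSign`.
  elementSum-sign : ∀ {n} (I : Subset n) →
    (- 1#) ^ elementSum I ≈ triangularSign ∣ I ∣ * laplaceSign ∣ I ∣ I
  elementSum-sign Vec.[] = sym (*-identityˡ 1#)
  elementSum-sign (inside Vec.∷ I) = begin
    (- 1#) ^ elementSum (inside Vec.∷ I)          ≡⟨ ≡.cong (λ s → (- 1#) ^ suc s) (foldr-+-suc (λ j → suc (toℕ (element I j)))) ⟩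
    - 1# * (- 1#) ^ (∣ I ∣ ℕ.+ elementSum I)      ≈⟨ *-congˡ (trans (^-homo-* (- 1#) ∣ I ∣ (elementSum I)) (*-congˡ (elementSum-sign I))) ⟩
    - 1# * ((- 1#) ^ ∣ I ∣ * (triangularSign ∣ I ∣ * laplaceSign ∣ I ∣ I))
      ≈⟨ solve 4 (λ m p t l → m :* (p :* (t :* l)) := m :* p :* t :* l) refl (- 1#) _ _ _ ⟩
    - 1# * (- 1#) ^ ∣ I ∣ * triangularSign ∣ I ∣ * laplaceSign ∣ I ∣ I ∎
    where open ≈R
  elementSum-sign (outside Vec.∷ I) = begin
    (- 1#) ^ elementSum (outside Vec.∷ I)         ≡⟨ ≡.cong ((- 1#) ^_) (foldr-+-suc (λ j → suc (toℕ (element I j)))) ⟩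
    (- 1#) ^ (∣ I ∣ ℕ.+ elementSum I)             ≈⟨ trans (^-homo-* (- 1#) ∣ I ∣ (elementSum I)) (*-congˡ (elementSum-sign I)) ⟩
    (- 1#) ^ ∣ I ∣ * (triangularSign ∣ I ∣ * laplaceSign ∣ I ∣ I)
      ≈⟨ solve 3 (λ p t l → p :* (t :* l) := t :* (p :* l)) refl _ _ _ ⟩
    triangularSign ∣ I ∣ * ((- 1#) ^ ∣ I ∣ * laplaceSign ∣ I ∣ I) ∎
    where open ≈R

  module _ {n k} (k≤n : k ℕ.≤ n) (X : Gr (n ∸ k) n) (W : Gr k n) where

    private
      -- The sign common to all adjoint coefficients, times the sign by which element sums and
      -- Laplace signs differ. Working only with its being nonzero avoids relating the integer
      -- division in the exponent to 1 + ... + k.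
      unit-factor : Carrier
      unit-factor = (- 1#) ^ (k ℕ.* suc k ℕ./ 2) * triangularSign k

      stacked : Carrier
      stacked = Det (tabulate (basis W) ++ tabulate (basis X)) (tabulate id)

      k+[n∸k]≡n : k ℕ.+ (n ∸ k) ≡ n
      k+[n∸k]≡n = ℕₚ.m+[n∸m]≡n k≤n

    -- Up to a common factor, the signs in the adjoint coefficients are those of the Laplace
    -- expansion for the rows of W stacked on the rows of X.
    adjoint≈stacked : ∑ₛ n k (λ I → adjointCoefficient X I * Δ W I) ≈ unit-factor * stacked
    adjoint≈stacked = begin
      ∑ₛ n k (λ I → adjointCoefficient X I * Δ W I)
        ≈⟨ ∑ₛ-cong n k term ⟩
      ∑ₛ n k (λ I → unit-factor * laplaceTerm k (tabulate (basis W)) (tabulate (basis X)) id I)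
        ≈⟨ *-distribˡ-∑ₛ n k unit-factor _ ⟨
      unit-factor * ∑ₛ n k (laplaceTerm k (tabulate (basis W)) (tabulate (basis X)) id)
        ≈⟨ *-congˡ (laplace n k (tabulate (basis W)) (tabulate (basis X)) id (Listₚ.length-tabulate (basis W))) ⟩
      unit-factor * stacked ∎
      where
      open ≈R
      term : ∀ I → adjointCoefficient X I * Δ W I ≈
                   unit-factor * laplaceTerm k (tabulate (basis W)) (tabulate (basis X)) id I
      term I@(J , ≡.refl) = begin
        (- 1#) ^ (k ℕ.* suc k ℕ./ 2 ℕ.+ elementSum J) * Δ X (complement I) * Δ W I
          ≈⟨ *-cong (*-cong (trans (^-homo-* (- 1#) (k ℕ.* suc k ℕ./ 2) (elementSum J)) (*-congˡ (elementSum-sign J)))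
                            (minor≈Det (basis X) (complement I)))
                    (minor≈Det (basis W) I) ⟩
        (- 1#) ^ (k ℕ.* suc k ℕ./ 2) * (triangularSign k * laplaceSign k J) * _ * _
          ≈⟨ solve 5 (λ s t l x w → s :* (t :* l) :* x :* w := s :* t :* (l :* (w :* x))) refl _ _ _ _ _ ⟩
        unit-factor * laplaceTerm k (tabulate (basis W)) (tabulate (basis X)) id I ∎

    adjointHyperplane⇒¬trivial : adjointHyperplane {n} {k} X (Δ W) →
                                 ¬ (∀ {v} → carrier W v → carrier X v → v ≋ 𝟎)
    adjointHyperplane⇒¬trivial h trivial =
      proj₁ (Det-stack k+[n∸k]≡n (basis W) (basis X))
        (independent-++ (basis W) (basis X) (proj₁ (isBasis W)) (proj₁ (isBasis X))
          (λ v∈W v∈X → trivial (proj₂ (proj₂ (isBasis W)) v∈W) (proj₂ (proj₂ (isBasis X)) v∈X)))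
        (*-cancelˡ-zero (*-≉0 (^-≉0 (k ℕ.* suc k ℕ./ 2) -1≉0) (triangularSign-≉0 k)) (trans (sym adjoint≈stacked) h))

    ¬trivial⇒adjointHyperplane : ¬ (∀ {v} → carrier W v → carrier X v → v ≋ 𝟎) →
                                 adjointHyperplane {n} {k} X (Δ W)
    ¬trivial⇒adjointHyperplane ¬trivial = trans adjoint≈stacked (trans
      (*-congˡ (proj₂ (Det-stack k+[n∸k]≡n (basis W) (basis X))
        (λ indep → ¬trivial (λ v∈W v∈X → independent-++⇒trivial (basis W) (basis X) indep
          (proj₁ (proj₂ (isBasis W)) v∈W) (proj₁ (proj₂ (isBasis X)) v∈X)))))
      (zeroʳ _))

  -- Orthogonality

  ⊥-rowSpace : ∀ {d n} (u : ℝ^ n) (A : Matrix d n) → (∀ i → ⟨ u , A i ⟩ ≈ 0#) →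
               ∀ {w} → RowSpace A w → ⟨ u , w ⟩ ≈ 0#
  ⊥-rowSpace u A u⊥A {w} (c , w≋cA) = begin
    ⟨ u , w ⟩                      ≈⟨ ⟨⟩-cong {u = u} (λ _ → refl) w≋cA ⟩
    ⟨ u , combination c A ⟩        ≈⟨ ⟨⟩-combinationʳ u c A ⟩
    sum (λ i → c i * ⟨ u , A i ⟩)  ≈⟨ sum-zero (λ i → trans (*-congˡ (u⊥A i)) (zeroʳ (c i))) ⟩
    0#                             ∎
    where open ≈R

  -- One step of the Gram–Schmidt process per row.
  project : ∀ {d n} (A : Matrix d n) (α : ℝ^ n) → ∃ (IsOrthogonalProjection (RowSpace A) α)
  project {zero}  A α = 𝟎 , (F.[] , λ _ → refl) , λ w → ⊥-rowSpace _ A λ ()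
  project {suc d} A α = β , β∈A , λ w → ⊥-rowSpace (α ⊖ β) A λ
    { zero → (begin
        ⟨ γ , A zero ⟩             ≈⟨ ⟨⟩-cong {u = γ} (λ _ → refl) (λ j → solve 2 (λ a p → a := (a :- p) :+ p) refl (A zero j) (p₀ j)) ⟩
        ⟨ γ , u ⊕ p₀ ⟩             ≈⟨ ⟨⟩-⊕ʳ γ u p₀ ⟩
        ⟨ γ , u ⟩ + ⟨ γ , p₀ ⟩     ≈⟨ +-cong γ⊥u (⊥-rowSpace γ T γ⊥T p₀∈T) ⟩
        0# + 0#                    ≈⟨ +-identityˡ 0# ⟩
        0#                         ∎)
    ; (suc i) → γ⊥T i }
    where
    open ≈R
    T = A ∘ suc
    tail⊆ : RowSpace T ⊆ RowSpace A
    tail⊆ (c , e) = 0# F.∷ c , λ j → trans (e j) (sym (trans (+-congʳ (zeroˡ _)) (+-identityˡ _)))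
    p₀ = proj₁ (project T (A zero))
    p₀∈T = proj₁ (proj₂ (project T (A zero)))
    b = proj₁ (project T α)
    b∈T = proj₁ (proj₂ (project T α))
    u = A zero ⊖ p₀
    u⊥T : ∀ {w} → RowSpace T w → ⟨ u , w ⟩ ≈ 0#
    u⊥T = proj₂ (proj₂ (project T (A zero))) _
    -- If ⟨ u , u ⟩ vanishes, then u is zero by definiteness and t = 0 serves; this is the case of a
    -- first row in the span of the others.
    coefficient : ∃ λ t → ⟨ α , u ⟩ ≈ t * ⟨ u , u ⟩
    coefficient with ⟨ u , u ⟩ ≈? 0#
    ... | yes uu≈0 = 0# , trans (⟨⟩-cong {u = α} (λ _ → refl) (⟨⟩-definite u uu≈0))
                                (trans (⟨⟩-𝟎ʳ α) (sym (zeroˡ _)))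
    ... | no  uu≉0 =
      let y , e = inverse _ uu≉0
      in ⟨ α , u ⟩ * y , sym (trans (*-assoc _ y _) (trans (*-congˡ (trans (*-comm y _) e)) (*-identityʳ _)))
    t = proj₁ coefficient
    β = b ⊕ t ⊙ u
    β∈A : RowSpace A β
    β∈A = ∋-⊕ (rowSpace-isSubspace A) (tail⊆ b∈T)
      (∋-⊙ (rowSpace-isSubspace A) t (∋-⊖ (rowSpace-isSubspace A) (row∈RowSpace A zero) (tail⊆ p₀∈T)))
    γ = α ⊖ β
    expand : ∀ w → ⟨ γ , w ⟩ ≈ ⟨ α , w ⟩ - (⟨ b , w ⟩ + t * ⟨ u , w ⟩)
    expand w = trans (⟨⟩-⊖ˡ α β w) (+-congˡ (-‿cong (trans (⟨⟩-⊕ˡ b (t ⊙ u) w) (+-congˡ (⟨⟩-⊙ˡ t u w)))))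
    γ⊥T : ∀ i → ⟨ γ , T i ⟩ ≈ 0#
    γ⊥T i = begin
      ⟨ γ , T i ⟩                                        ≈⟨ expand (T i) ⟩
      ⟨ α , T i ⟩ - (⟨ b , T i ⟩ + t * ⟨ u , T i ⟩)      ≈⟨ +-congˡ (-‿cong (trans (+-congˡ (trans (*-congˡ (u⊥T (row∈RowSpace T i))) (zeroʳ t))) (+-identityʳ _))) ⟩
      ⟨ α , T i ⟩ - ⟨ b , T i ⟩                          ≈⟨ ⟨⟩-⊖ˡ α b (T i) ⟨
      ⟨ α ⊖ b , T i ⟩                                    ≈⟨ proj₂ (proj₂ (project T α)) _ (row∈RowSpace T i) ⟩
      0#                                                 ∎
    γ⊥u : ⟨ γ , u ⟩ ≈ 0#
    γ⊥u = begin
      ⟨ γ , u ⟩                                  ≈⟨ expand u ⟩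
      ⟨ α , u ⟩ - (⟨ b , u ⟩ + t * ⟨ u , u ⟩)    ≈⟨ +-cong (proj₂ coefficient) (-‿cong (trans (+-congʳ (trans (⟨⟩-comm b u) (u⊥T b∈T))) (+-identityˡ _))) ⟩
      t * ⟨ u , u ⟩ - t * ⟨ u , u ⟩              ≈⟨ -‿inverseʳ _ ⟩
      0#                                         ∎

  -- This turns conditions ⟨ α i , v ⟩ ≈ 0# defining flats into orthogonality to the projected
  -- normals, for v in W.
  projection-pairing : ∀ {n} {W : Pred (ℝ^ n) 0ℓ} {α β v : ℝ^ n} → IsOrthogonalProjection W α β →
                       W v → ⟨ α , v ⟩ ≈ ⟨ β , v ⟩
  projection-pairing {α = α} {β} {v} (_ , ⊥W) Wv =
    x∙y⁻¹≈ε⇒x≈y _ _ (trans (sym (⟨⟩-⊖ˡ α β v)) (⊥W v Wv))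

  gr-project : ∀ {k n} (W : Gr k n) (α : ℝ^ n) → ∃ (IsOrthogonalProjection (carrier W) α)
  gr-project W α =
    let β , β∈ , ⊥ = project (basis W) α
        _ , W⊆ , ⊆W = isBasis W
    in β , ⊆W β∈ , λ w Ww → ⊥ w (W⊆ Ww)

  -- Here T is the orthogonal complement of S within U. Bases of S and T stack to a basis of U:
  -- independent by definiteness, and spanning because v minus its projection to S lies in T.
  orthogonal-dimension : ∀ {n s t u} {S T U : Pred (ℝ^ n) 0ℓ} → HasDim S s → HasDim T t → HasDim U u →
    S ⊆ U → T ⊆ U → (∀ {v w} → T v → S w → ⟨ v , w ⟩ ≈ 0#) →
    (∀ {v} → U v → (∀ {w} → S w → ⟨ v , w ⟩ ≈ 0#) → T v) → s ℕ.+ t ≡ u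
  orthogonal-dimension {n} {s} {t} {U = U} (A , indepA , S⊆A , A⊆S) (B , indepB , T⊆B , B⊆T) dimU S⊆U T⊆U T⊥S S⊥⊆T =
    hasDim-unique (A F.++ B , indep , U⊆ , RowSpace⊆ U-sub (A F.++ B)
      (all-++ U A B (λ i → S⊆U (A⊆S (row∈RowSpace A i))) (λ i → T⊆U (B⊆T (row∈RowSpace B i))))) dimU
    where
    U-sub = hasDim⇒isSubspace dimU
    indep : LinearlyIndependent (A F.++ B)
    indep = independent-++ A B indepA indepB λ {v} v∈A v∈B → ⟨⟩-definite v (T⊥S (B⊆T v∈B) (A⊆S v∈A))
    U⊆ : U ⊆ RowSpace (A F.++ B)
    U⊆ {v} Uv =
      let β , β∈A , ⊥ = project A v
      in ∋-resp (rowSpace-isSubspace (A F.++ B)) (λ j → solve 2 (λ b v → b :+ (v :- b) := v) refl (β j) (v j))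
           (rowSpace-++ A B β∈A (T⊆B (S⊥⊆T (∋-⊖ U-sub Uv (S⊆U (A⊆S β∈A))) (⊥ _ ∘ S⊆A))))

  hyperplane-isSubspace : ∀ {n} (a : ℝ^ n) → IsSubspace (hyperplane a)
  hyperplane-isSubspace a = record
    { ∋-resp = λ u≋v e → trans (⟨⟩-cong {u = a} (λ _ → refl) (≋-sym u≋v)) e
    ; ∋-𝟎    = ⟨⟩-𝟎ʳ a
    ; ∋-⊕    = λ {u} {v} eu ev → trans (⟨⟩-⊕ʳ a u v) (trans (+-cong eu ev) (+-identityˡ 0#))
    ; ∋-⊙    = λ c {v} e → trans (⟨⟩-⊙ʳ a c v) (trans (*-congˡ e) (zeroʳ c))
    }

  -- The vector y and a basis of the section form a basis of Y: a vector of Y enters the section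
  -- once the multiple of y with the same pairing against a is subtracted.
  section-dim : ∀ {n d e} {Y : Pred (ℝ^ n) 0ℓ} (a : ℝ^ n) {y : ℝ^ n} → Y y → ⟨ a , y ⟩ ≉ 0# →
                HasDim Y d → HasDim (Y ∩ hyperplane a) e → d ≡ suc e
  section-dim {n} {Y = Y} a {y} Yy ay≉0 dimY (B , indepB , ⊆B , B⊆) = hasDim-unique dimY
    ( y F.∷ B
    , independent-∷ y B indepB (ay≉0 ∘ proj₂ ∘ B⊆)
    , (λ {v} Yv → let c = ⟨ a , v ⟩ * y⁻¹
                      b , e = ⊆B (∋-⊖ Y-sub Yv (∋-⊙ Y-sub c Yy) , (begin
                        ⟨ a , v ⊖ c ⊙ y ⟩              ≈⟨ trans (⟨⟩-comm a _) (trans (⟨⟩-⊖ˡ v (c ⊙ y) a) (+-cong (⟨⟩-comm v a) (-‿cong (trans (⟨⟩-⊙ˡ c y a) (*-congˡ (⟨⟩-comm y a)))))) ⟩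
                        ⟨ a , v ⟩ - c * ⟨ a , y ⟩      ≈⟨ solve 3 (λ v i y → v :- v :* i :* y := v :- v :* (y :* i)) refl _ y⁻¹ _ ⟩
                        ⟨ a , v ⟩ - ⟨ a , v ⟩ * (⟨ a , y ⟩ * y⁻¹) ≈⟨ +-congˡ (-‿cong (trans (*-congˡ ayy⁻¹≈1) (*-identityʳ _))) ⟩
                        ⟨ a , v ⟩ - ⟨ a , v ⟩          ≈⟨ -‿inverseʳ _ ⟩
                        0#                             ∎))
                  in c F.∷ b , λ j → trans (solve 2 (λ v s → v := s :+ (v :- s)) refl (v j) (c * y j)) (+-congˡ (e j)))
    , RowSpace⊆ Y-sub (y F.∷ B) (λ { zero → Yy ; (suc i) → proj₁ (B⊆ (row∈RowSpace B i)) }))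
    where
    open ≈R
    Y-sub = hasDim⇒isSubspace dimY
    y⁻¹ = proj₁ (inverse _ ay≉0)
    ayy⁻¹≈1 = proj₂ (inverse _ ay≉0)

  section-dim-≤ : ∀ {n d e} {Y : Pred (ℝ^ n) 0ℓ} (a : ℝ^ n) →
                  HasDim Y d → HasDim (Y ∩ hyperplane a) e → d ℕ.≤ suc e
  section-dim-≤ {Y = Y} a dimY dimYₐ with decide₀ (∃ λ y → Y y × ⟨ a , y ⟩ ≉ 0#)
  ... | yes (y , Yy , ay≉0) = ℕₚ.≤-reflexive (section-dim a Yy ay≉0 dimY dimYₐ)
  ... | no ¬y = ℕₚ.m≤n⇒m≤1+n (hasDim-mono dimY dimYₐ (λ {v} Yv → Yv , ¬¬-elim (λ av≉0 → ¬y (v , Yv , av≉0))))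

  -- Spans of subfamilies

  unit-≢ : ∀ {d} {i j : Fin d} → ¬ i ≡ j → unit i j ≈ 0#
  unit-≢ {i = zero}  {zero}  i≢j = contradiction ≡.refl i≢j
  unit-≢ {i = zero}  {suc j} i≢j = refl
  unit-≢ {i = suc i} {zero}  i≢j = refl
  unit-≢ {i = suc i} {suc j} i≢j = unit-≢ (i≢j ∘ ≡.cong suc)

  module _ {m n} (β : Matrix m n) where

    spanOf-isSubspace : ∀ I → IsSubspace (SpanOf β I)
    spanOf-isSubspace I = record
      { ∋-resp = λ u≋v (c , off , e) → c , off , ≋-trans (≋-sym u≋v) e
      ; ∋-𝟎    = 𝟎 , (λ _ _ → refl) , ≋-sym (combination-𝟎 β)
      ; ∋-⊕    = λ (c , off , e) (c′ , off′ , e′) → c ⊕ c′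
                 , (λ i i∉I → trans (+-cong (off i i∉I) (off′ i i∉I)) (+-identityˡ 0#))
                 , λ j → trans (+-cong (e j) (e′ j)) (sym (combination-⊕ c c′ β j))
      ; ∋-⊙    = λ s (c , off , e) → s ⊙ c
                 , (λ i i∉I → trans (*-congˡ (off i i∉I)) (zeroʳ s))
                 , λ j → trans (*-congˡ (e j)) (sym (combination-⊙ s c β j))
      }

    row∈spanOf : ∀ {I i} → i Sub.∈ I → SpanOf β I (β i)
    row∈spanOf {i = i} i∈I = unit i
      , (λ j j∉I → unit-≢ (λ i≡j → j∉I (≡.subst (Sub._∈ _) i≡j i∈I)))
      , ≋-sym (combination-unit i β)

    spanOf⊆ : ∀ {I} {W : Pred (ℝ^ n) 0ℓ} → IsSubspace W → (∀ {i} → i Sub.∈ I → W (β i)) → SpanOf β I ⊆ W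
    spanOf⊆ {I} S W∋ (c , off , e) = ∋-resp S (≋-sym e)
      (∋-combination S c β (λ i cᵢ≉0 → W∋ (¬¬-elim (λ i∉I → cᵢ≉0 (off i i∉I)))))

  -- Flats

  element-surjective : ∀ {m} {I : Subset m} {i} → i Sub.∈ I → ∃ λ j → element I j ≡ i
  element-surjective {I = inside  Vec.∷ I} Vec.here = zero , ≡.refl
  element-surjective {I = inside  Vec.∷ I} (Vec.there i∈I) =
    let j , e = element-surjective i∈I in suc j , ≡.cong suc e
  element-surjective {I = outside Vec.∷ I} (Vec.there i∈I) =
    let j , e = element-surjective i∈I in j , ≡.cong suc e

  spanOf-mono : ∀ {m n} (β : Matrix m n) {I J} → I Sub.⊆ J → SpanOf β I ⊆ SpanOf β J
  spanOf-mono β {I} {J} I⊆J = spanOf⊆ β (spanOf-isSubspace β J) (row∈spanOf β ∘ I⊆J)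

  -- A basis C of span (I ∩ J) is extended by E to a basis of span I and
  -- by F to one of span J; then E, F and C together span span (I ∪ J).
  spanOf-submodular : ∀ {m n s c p q} (β : Matrix m n) I J →
    HasDim (SpanOf β (I Sub.∪ J)) s → HasDim (SpanOf β (I Sub.∩ J)) c →
    HasDim (SpanOf β I) p → HasDim (SpanOf β J) q → s ℕ.+ c ℕ.≤ p ℕ.+ q
  spanOf-submodular {s = s} {c} {p} {q} β I J dim∪ (C , basisC@(indepC , _)) dimI dimJ
    with extend C indepC (SpanOf β I) | extend C indepC (SpanOf β J)
  ... | e , E , E⊆ , indepE , I⊆E | f , F , F⊆ , indepF , J⊆F = begin
    s ℕ.+ c                     ≤⟨ ℕₚ.+-monoˡ-≤ c (hasDim-≤-spanning dim∪ (E F.++ (F F.++ C)) ∪⊆) ⟩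
    e ℕ.+ (f ℕ.+ c) ℕ.+ c       ≡⟨ ≡.cong (ℕ._+ c) (≡.trans (≡.cong (e ℕ.+_) (ℕₚ.+-comm f c)) (≡.sym (ℕₚ.+-assoc e c f))) ⟩
    e ℕ.+ c ℕ.+ f ℕ.+ c         ≡⟨ ℕₚ.+-assoc (e ℕ.+ c) f c ⟩
    (e ℕ.+ c) ℕ.+ (f ℕ.+ c)     ≡⟨ ≡.cong₂ ℕ._+_ (hasDim-unique dimEC dimI) (hasDim-unique dimFC dimJ) ⟩
    p ℕ.+ q                     ∎
    where
    open ℕₚ.≤-Reasoning
    C∈ : ∀ i → SpanOf β (I Sub.∩ J) (C i)
    C∈ = basis-rows C basisC
    dimEC : HasDim (SpanOf β I) (e ℕ.+ c)
    dimEC = E F.++ C , indepE , I⊆E , RowSpace⊆ (spanOf-isSubspace β I) (E F.++ C)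
      (all-++ (SpanOf β I) E C E⊆ (spanOf-mono β (Subₚ.p∩q⊆p I J) ∘ C∈))
    dimFC : HasDim (SpanOf β J) (f ℕ.+ c)
    dimFC = F F.++ C , indepF , J⊆F , RowSpace⊆ (spanOf-isSubspace β J) (F F.++ C)
      (all-++ (SpanOf β J) F C F⊆ (spanOf-mono β (Subₚ.p∩q⊆q I J) ∘ C∈))
    EFC = rowSpace-isSubspace (E F.++ (F F.++ C))
    EC⊆EFC : RowSpace (E F.++ C) ⊆ RowSpace (E F.++ (F F.++ C))
    EC⊆EFC = RowSpace⊆ EFC (E F.++ C) (all-++ (RowSpace (E F.++ (F F.++ C))) E C
      (rowSpace-++ˡ E (F F.++ C) ∘ row∈RowSpace E)
      (rowSpace-++ʳ E (F F.++ C) ∘ rowSpace-++ʳ F C ∘ row∈RowSpace C))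
    ∪⊆ : SpanOf β (I Sub.∪ J) ⊆ RowSpace (E F.++ (F F.++ C))
    ∪⊆ = spanOf⊆ β EFC λ i∈ → case Subₚ.x∈p∪q⁻ I J i∈ of λ where
      (inj₁ i∈I) → EC⊆EFC (I⊆E (row∈spanOf β i∈I))
      (inj₂ i∈J) → rowSpace-++ʳ E (F F.++ C) (J⊆F (row∈spanOf β i∈J))

  spanMatroid : ∀ {m n} → Matrix m n → Matroid m
  spanMatroid β = record
    { rank            = proj₁ ∘ dim
    ; rank≤∣∣         = λ I → hasDim-≤-spanning (proj₂ (dim I)) (β ∘ element I)
        (spanOf⊆ β (rowSpace-isSubspace (β ∘ element I)) (λ {i} i∈I →
          let j , e = element-surjective i∈I
          in ≡.subst (RowSpace (β ∘ element I)) (≡.cong β e) (row∈RowSpace (β ∘ element I) j)))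
    ; rank-mono       = λ {I} {J} I⊆J → hasDim-mono (proj₂ (dim I)) (proj₂ (dim J)) (spanOf-mono β I⊆J)
    ; rank-submodular = λ I J → spanOf-submodular β I J (proj₂ (dim (I Sub.∪ J))) (proj₂ (dim (I Sub.∩ J))) (proj₂ (dim I)) (proj₂ (dim J))
    }
    where
    dim : ∀ I → ∃ (HasDim (SpanOf β I))
    dim I = dimension (spanOf-isSubspace β I)

  support : ∀ {m} → Pred (Fin m) 0ℓ → Subset m
  support J = Vec.tabulate (λ i → does (decide₀ (J i)))

  ∈-support⁺ : ∀ {m} {J : Pred (Fin m) 0ℓ} {i} → J i → i Sub.∈ support J
  ∈-support⁺ {J = J} {i} Ji = Vecₚ.lookup⇒[]= i _ (≡.trans (Vecₚ.lookup∘tabulate _ i) (dec-true (decide₀ (J i)) Ji))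

  ∈-support⁻ : ∀ {m} {J : Pred (Fin m) 0ℓ} {i} → i Sub.∈ support J → J i
  ∈-support⁻ {J = J} {i} i∈ with decide₀ (J i) | ≡.trans (≡.sym (Vecₚ.lookup∘tabulate (λ i → does (decide₀ (J i))) i)) (Vecₚ.[]=⇒lookup i∈)
  ... | yes Ji | _ = Ji
  ... | no _   | ()

  gr-isSubspace : ∀ {k n} (W : Gr k n) → IsSubspace (carrier W)
  gr-isSubspace W = isSubspace-≐ (proj₂ (isBasis W)) (rowSpace-isSubspace (basis W))

  gr-hasDim : ∀ {k n} (W : Gr k n) → HasDim (carrier W) k
  gr-hasDim W = basis W , isBasis W

  toGr : ∀ {k n} {W : Pred (ℝ^ n) 0ℓ} → HasDim W k → Gr k n
  toGr {W = W} (A , basisA) = record { carrier = W ; basis = A ; isBasis = basisA }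

  L-≐ : ∀ {V : Set} {ℓ} {𝒜 : Pred (Pred V 0ℓ) ℓ} {X Y : Pred V 0ℓ} → X ≐ Y → L 𝒜 X → L 𝒜 Y
  L-≐ (X⊆Y , Y⊆X) (ℬ , ℬ⊆ , X⊆ , ⊆X) = ℬ , ℬ⊆ , X⊆ ∘ Y⊆X , X⊆Y ∘ ⊆X

  module Flats {n m : ℕ} (α : Matrix m n) where

    flat : Pred (Fin m) 0ℓ → Pred (ℝ^ n) 0ℓ
    flat J v = ∀ i → J i → hyperplane (α i) v

    flat-isSubspace : ∀ J → IsSubspace (flat J)
    flat-isSubspace J = record
      { ∋-resp = λ e Jv i Ji → ∋-resp (hyperplane-isSubspace (α i)) e (Jv i Ji)
      ; ∋-𝟎    = λ i Ji → ∋-𝟎 (hyperplane-isSubspace (α i))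
      ; ∋-⊕    = λ u v i Ji → ∋-⊕ (hyperplane-isSubspace (α i)) (u i Ji) (v i Ji)
      ; ∋-⊙    = λ c v i Ji → ∋-⊙ (hyperplane-isSubspace (α i)) c (v i Ji)
      }

    flat∈L : ∀ J → L (Arrangement α) (flat J)
    flat∈L J = (λ H → ∃ λ i → J i × H ≐ hyperplane (α i))
      , (λ (i , _ , H≐) → i , H≐)
      , (λ { Jv H (i , Ji , _ , ⊆H) → ⊆H (Jv i Ji) })
      , (λ ⋂v i Ji → ⋂v (hyperplane (α i)) (i , Ji , id , id))

    -- Taking all normals whose hyperplane contains X avoids choosing an index for each member of
    -- `ℬ`; every such member is one of these hyperplanes.
    L⇒flat : ∀ {X} → L (Arrangement α) X → ∃ λ J → X ≐ flat J
    L⇒flat {X} (ℬ , ℬ⊆ , X⊆ , ⊆X) = (λ i → X ⊆ hyperplane (α i))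
      , (λ Xv i X⊆H → X⊆H Xv)
      , (λ {v} Jv → ⊆X λ H ℬH →
          let i , H⊆ , ⊆H = ℬ⊆ ℬH in ⊆H (Jv i (λ Xu → H⊆ (X⊆ Xu H ℬH))))

    flat-∩ : ∀ J i → flat J ∩ hyperplane (α i) ≐ flat (λ j → J j ⊎ i ≡ j)
    flat-∩ J i = (λ { (Jv , Hv) j (inj₁ Jj) → Jv j Jj ; (Jv , Hv) j (inj₂ ≡.refl) → Hv })
      , (λ v → (λ j Jj → v j (inj₁ Jj)) , v i (inj₂ ≡.refl))

    flat-support : ∀ J → flat J ≐ flat (Sub._∈ support J)
    flat-support J = (λ v i i∈ → v i (∈-support⁻ i∈)) , (λ v i Ji → v i (∈-support⁺ Ji))

    L-isSubspace : ∀ {X} → L (Arrangement α) X → IsSubspace X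
    L-isSubspace LX = let J , X≐ = L⇒flat LX in isSubspace-≐ X≐ (flat-isSubspace J)

    L-section : ∀ {X} i → L (Arrangement α) X → L (Arrangement α) (X ∩ hyperplane (α i))
    L-section i LX =
      let J , X⊆ , ⊆X = L⇒flat LX
          ∩⊆ , ⊆∩ = flat-∩ J i
      in L-≐ ((λ v → let Jv , Hv = ⊆∩ v in ⊆X Jv , Hv) , (λ (Xv , Hv) → ∩⊆ (X⊆ Xv , Hv))) (flat∈L _)

    module _ {k : ℕ} where

      nullity : Gr k n → Subset m → ℕ
      nullity W I = proj₁ (dimension (∩-isSubspace (gr-isSubspace W) (flat-isSubspace (Sub._∈ I))))

      hasNullity : ∀ W I → HasDim (carrier W ∩ flat (Sub._∈ I)) (nullity W I)
      hasNullity W I = proj₂ (dimension (∩-isSubspace (gr-isSubspace W) (flat-isSubspace (Sub._∈ I))))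

      infix 4 _∼_

      _∼_ : Gr k n → Gr k n → Set
      W ∼ W′ = ∀ I → nullity W I ≡ nullity W′ I

      -- Equivalence is stated for finite index sets only; it reaches every X of the lattice because
      -- X is the flat of some `support`.
      ∩-hasDim : ∀ {W W′ X d} → W ∼ W′ → L (Arrangement α) X → HasDim (carrier W ∩ X) d → HasDim (carrier W′ ∩ X) d
      ∩-hasDim {W} {W′} {X} W∼W′ LX dim =
        let J , X⊆J , J⊆X = L⇒flat LX
            J⊆I , I⊆J = flat-support J
            I = support J
            nullity≡ = hasDim-unique (hasNullity W I)
              (hasDim-≐ ((λ (Wv , Xv) → Wv , J⊆I (X⊆J Xv)) , (λ (Wv , Iv) → Wv , J⊆X (I⊆J Iv))) dim)
        in hasDim-≐ ((λ (Wv , Iv) → Wv , J⊆X (I⊆J Iv)) , (λ (Wv , Xv) → Wv , J⊆I (X⊆J Xv)))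
             (≡.subst (HasDim _) (≡.trans (≡.sym (W∼W′ I)) nullity≡) (hasNullity W′ I))

      Projections : Gr k n → Matrix m n → Set
      Projections W β = ∀ i → IsOrthogonalProjection (carrier W) (α i) (β i)

      projections : ∀ W → ∃ (Projections W)
      projections W = proj₁ ∘ gr-project W ∘ α , proj₂ ∘ gr-project W ∘ α

      -- A vector of W pairs alike with α i and β i, so W ∩ flat I is the orthogonal complement,
      -- within W, of the span of the β i over I.
      rank-nullity : ∀ {W β I r} → Projections W β → HasDim (SpanOf β I) r → r ℕ.+ nullity W I ≡ k
      rank-nullity {W} {β} {I} proj dim = orthogonal-dimension dim (hasNullity W I) (gr-hasDim W)
        (spanOf⊆ β (gr-isSubspace W) (λ {i} _ → proj₁ (proj i)))
        proj₁
        (λ {v} (Wv , Iv) → spanOf⊆ β {I} (hyperplane-isSubspace v) (λ {i} i∈I →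
          trans (⟨⟩-comm v (β i)) (trans (sym (projection-pairing (proj i) Wv)) (Iv i i∈I))))
        (λ {v} Wv v⊥ → Wv , λ i i∈I →
          trans (projection-pairing (proj i) Wv) (trans (⟨⟩-comm (β i) v) (v⊥ (row∈spanOf β i∈I))))

  -- Matroid strata

  MeetTrivially : ∀ {n k l} → Gr k n → Gr l n → Set
  MeetTrivially W X = ∀ {v} → carrier W v → carrier X v → v ≋ 𝟎

  module Essentially {n m : ℕ} (α : Matrix m n) (essential : Essential (Arrangement α)) {k : ℕ} where

    open Flats α

    𝒜 : Pred (Pred (ℝ^ n) 0ℓ) 0ℓ
    𝒜 = Arrangement α

    -- The only form in which essentiality enters the proof.
    normals-span : ∀ {v} → (∀ i → ⟨ α i , v ⟩ ≈ 0#) → v ≋ 𝟎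
    normals-span α⊥v = proj₁ essential (λ H (i , _ , ⊆H) → ⊆H (α⊥v i))

    -- Empty and repeated strata are allowed: the conditions say that each stratum is empty or a
    -- single class of `_∼_`, and that every class occurs.
    record Classifies {ℓ} {I : Set₁} (S : I → Pred (Gr k n) ℓ) : Set (lsuc 0ℓ Level.⊔ ℓ) where
      field
        covers   : ∀ W → ∃ λ i → S i W
        sound    : ∀ {i W W′} → S i W → S i W′ → W ∼ W′
        complete : ∀ {i W W′} → S i W → W ∼ W′ → S i W′

    open Classifies

    nonemptyStrata-⊆ : ∀ {ℓ ℓ′} {I J : Set₁} {S : I → Pred (Gr k n) ℓ} {T : J → Pred (Gr k n) ℓ′} →
                       Classifies S → Classifies T → NonemptyStrata S ⊆ NonemptyStrata T
    nonemptyStrata-⊆ CS CT ((W , ZW) , i , Z⊆S , S⊆Z) =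
      let j , TW = covers CT W
      in (W , ZW) , j , (λ ZV → complete CT TW (sound CS (Z⊆S ZW) (Z⊆S ZV)))
                      , (λ TV → S⊆Z (complete CS (Z⊆S ZW) (sound CT TW TV)))

    matroidStratum-nullity : ∀ {𝔐 W} → matroidStratumOf α 𝔐 W → ∀ I → rank 𝔐 I ℕ.+ nullity W I ≡ k
    matroidStratum-nullity {W = W} (β , proj , dim) I = rank-nullity {W = W} proj (dim I)

    matroid-classifies : Classifies (matroidStratum {k = k} α)
    matroid-classifies = record
      { covers   = λ W →
          let β , proj = projections W
              stratum  = β , proj , λ I → proj₂ (dimension (spanOf-isSubspace β I))
          in (spanMatroid β , W , stratum) , stratum
      ; sound    = λ {(𝔐 , _)} {W} {W′} SW SW′ I → ℕₚ.+-cancelˡ-≡ (rank 𝔐 I) _ _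
          (≡.trans (matroidStratum-nullity {𝔐} {W} SW I) (≡.sym (matroidStratum-nullity {𝔐} {W′} SW′ I)))
      ; complete = λ {(𝔐 , _)} {W} {W′} SW W∼W′ →
          let β , proj = projections W′
          in β , proj , λ I →
            let r , dim = dimension (spanOf-isSubspace β I)
            in ≡.subst (HasDim _) (ℕₚ.+-cancelʳ-≡ (nullity W′ I) _ _
                 (≡.trans (rank-nullity {W = W′} proj dim)
                   (≡.trans (≡.sym (matroidStratum-nullity {𝔐} {W} SW I)) (≡.cong (rank 𝔐 I ℕ.+_) (W∼W′ I))))) dim
      }

    matroid-decomposition : IsDecomposition _≈ᴹ_ (matroidStratum {k = k} α)
    matroid-decomposition = record
      { covers   = covers matroid-classifies
      ; disjoint = λ {(𝔐 , _)} {(𝔑 , _)} 𝔐≉𝔑 {W} (SW , TW) → 𝔐≉𝔑 λ I → ℕₚ.+-cancelʳ-≡ (nullity W I) _ _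
          (≡.trans (matroidStratum-nullity {𝔐} {W} SW I) (≡.sym (matroidStratum-nullity {𝔑} {W} TW I)))
      }

    -- The projections of α to W contain a basis B of W that extends a basis of
    -- span I; the corresponding normals are independent, so that they cut out a
    -- flat X of rank k with W ∩ X = 0.  From W′ ∩ X = 0 it follows that the
    -- projections of the same normals span W′.
    trivialMeets⇒nullity-≤ : ∀ {W W′} →
      (∀ (X : Gr (n ∸ k) n) → L 𝒜 (carrier X) → MeetTrivially W X → MeetTrivially W′ X) →
      ∀ I → nullity W′ I ℕ.≤ nullity W I
    trivialMeets⇒nullity-≤ {W} {W′} transfer I = conclusion
      where
      open ≈R
      β = proj₁ (projections W)
      projβ = proj₂ (projections W)
      β′ = proj₁ (projections W′)
      projβ′ = proj₂ (projections W′)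

      -- Extending by the vectors β i themselves, not by their span, makes every row of A a
      -- projected normal, whose index in I is recorded by φ.
      first = extend F.[] independent-[] (λ v → ∃ λ i → i Sub.∈ I × β i ≡ v)
      r = proj₁ first ℕ.+ 0
      A : Matrix r n
      A = proj₁ (proj₂ first) F.++ F.[]
      A∈ : ∀ i → ∃ λ j → j Sub.∈ I × β j ≡ A i
      A∈ = all-++ (λ v → ∃ λ i → i Sub.∈ I × β i ≡ v) (proj₁ (proj₂ first)) F.[] (proj₁ (proj₂ (proj₂ first))) λ ()
      indepA = proj₁ (proj₂ (proj₂ (proj₂ first)))
      φ : Fin r → Fin m
      φ = proj₁ ∘ A∈

      dimI : HasDim (SpanOf β I) r
      dimI = A , indepA
        , spanOf⊆ β (rowSpace-isSubspace A) (λ {i} i∈I → proj₂ (proj₂ (proj₂ (proj₂ first))) (i , i∈I , ≡.refl))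
        , RowSpace⊆ (spanOf-isSubspace β I) A (λ i → ≡.subst (SpanOf β I) (proj₂ (proj₂ (A∈ i))) (row∈spanOf β (proj₁ (proj₂ (A∈ i)))))

      -- The number e of vectors added here will turn out to be k minus the rank of I, that is, the
      -- nullity of W at I.
      second = extend A indepA (λ v → ∃ λ i → β i ≡ v)
      e = proj₁ second
      E = proj₁ (proj₂ second)
      E∈ = proj₁ (proj₂ (proj₂ second))
      ψ : Fin e → Fin m
      ψ = proj₁ ∘ E∈
      B = E F.++ A
      indepB = proj₁ (proj₂ (proj₂ (proj₂ second)))
      β∈B : ∀ i → RowSpace B (β i)
      β∈B i = proj₂ (proj₂ (proj₂ (proj₂ second))) (i , ≡.refl)

      χ : Fin (e ℕ.+ r) → Fin m
      χ = ψ F.++ φ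
      βχ≡B : ∀ i → β (χ i) ≡ B i
      βχ≡B = ↑-cases e
        (λ i → ≡.trans (≡.cong β (Fₚ.lookup-++ˡ ψ φ i)) (≡.trans (proj₂ (E∈ i)) (≡.sym (Fₚ.lookup-++ˡ E A i))))
        (λ i → ≡.trans (≡.cong β (Fₚ.lookup-++ʳ ψ φ i)) (≡.trans (proj₂ (proj₂ (A∈ i))) (≡.sym (Fₚ.lookup-++ʳ E A i))))
      B∈W : ∀ i → carrier W (B i)
      B∈W i = ≡.subst (carrier W) (βχ≡B i) (proj₁ (projβ (χ i)))

      J : Pred (Fin m) 0ℓ
      J i = ∃ λ j → χ j ≡ i

      B-pairing : ∀ {v} → carrier W v → ∀ i → ⟨ v , B i ⟩ ≈ ⟨ v , α (χ i) ⟩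
      B-pairing {v} Wv i = begin
        ⟨ v , B i ⟩        ≡⟨ ≡.cong ⟨ v ,_⟩ (βχ≡B i) ⟨
        ⟨ v , β (χ i) ⟩    ≈⟨ ⟨⟩-comm v _ ⟩
        ⟨ β (χ i) , v ⟩    ≈⟨ projection-pairing (projβ (χ i)) Wv ⟨
        ⟨ α (χ i) , v ⟩    ≈⟨ ⟨⟩-comm _ v ⟩
        ⟨ v , α (χ i) ⟩    ∎

      -- Such a v is orthogonal to B, whose row space contains every β i; on W this is orthogonality
      -- to every α i.
      W∩J-trivial : ∀ {v} → carrier W v → flat J v → v ≋ 𝟎
      W∩J-trivial {v} Wv Jv = normals-span λ i → begin
        ⟨ α i , v ⟩   ≈⟨ projection-pairing (projβ i) Wv ⟩
        ⟨ β i , v ⟩   ≈⟨ ⟨⟩-comm (β i) v ⟩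
        ⟨ v , β i ⟩   ≈⟨ ⊥-rowSpace v B (λ j → trans (B-pairing Wv j) (trans (⟨⟩-comm v _) (Jv (χ j) (j , ≡.refl)))) (β∈B i) ⟩
        0#            ∎

      e+r≡k : e ℕ.+ r ≡ k
      e+r≡k = ≡.trans (≡.sym (ℕₚ.+-identityʳ _)) (orthogonal-dimension (hasDim-rowSpace B indepB)
        (hasDim-trivial (∩-isSubspace (gr-isSubspace W) (flat-isSubspace J)) (λ (Wv , Jv) → W∩J-trivial Wv Jv))
        (gr-hasDim W) (RowSpace⊆ (gr-isSubspace W) B B∈W) proj₁
        (λ {v} {w} (Wv , Jv) w∈B → trans (⟨⟩-cong {v = w} (W∩J-trivial Wv Jv) (λ _ → refl)) (trans (⟨⟩-comm 𝟎 w) (⟨⟩-𝟎ʳ w)))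
        (λ {v} Wv v⊥ → Wv , λ { _ (j , ≡.refl) →
          trans (⟨⟩-comm _ v) (trans (sym (B-pairing Wv j)) (v⊥ (row∈RowSpace B j))) }))

      -- The combination b of B with the same coefficients lies in W, so a dependency of the normals
      -- gives ⟨ b , b ⟩ ≈ 0#.
      indepα : LinearlyIndependent (α ∘ χ)
      indepα c cα≋0 = indepB c (⟨⟩-definite b (begin
        ⟨ b , b ⟩                              ≈⟨ ⟨⟩-combinationʳ b c B ⟩
        sum (λ i → c i * ⟨ b , B i ⟩)          ≈⟨ sum-cong-≋ (λ i → *-congˡ {c i} (B-pairing b∈W i)) ⟩
        sum (λ i → c i * ⟨ b , α (χ i) ⟩)      ≈⟨ ⟨⟩-combinationʳ b c (α ∘ χ) ⟨
        ⟨ b , combination c (α ∘ χ) ⟩          ≈⟨ ⟨⟩-cong {u = b} (λ _ → refl) cα≋0 ⟩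
        ⟨ b , 𝟎 ⟩                              ≈⟨ ⟨⟩-𝟎ʳ b ⟩
        0#                                     ∎))
        where
        b = combination c B
        b∈W : carrier W b
        b∈W = ∋-combination (gr-isSubspace W) c B (λ i _ → B∈W i)

      dimJ : ∃ (HasDim (flat J))
      dimJ = dimension (flat-isSubspace J)

      codimJ : (e ℕ.+ r) ℕ.+ proj₁ dimJ ≡ n
      codimJ = orthogonal-dimension (hasDim-rowSpace (α ∘ χ) indepα) (proj₂ dimJ) hasDim-full-space _ _
        (λ {v} Jv → ⊥-rowSpace v (α ∘ χ) (λ j → trans (⟨⟩-comm v _) (Jv (χ j) (j , ≡.refl))))
        (λ { {v} _ v⊥ _ (j , ≡.refl) → trans (⟨⟩-comm _ v) (v⊥ (row∈RowSpace (α ∘ χ) j)) })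

      X : Gr (n ∸ k) n
      X = toGr (≡.subst (HasDim (flat J))
        (≡.sym (≡.trans (≡.cong₂ _∸_ (≡.sym codimJ) (≡.sym e+r≡k)) (ℕₚ.m+n∸m≡n (e ℕ.+ r) (proj₁ dimJ)))) (proj₂ dimJ))

      W′∩J-trivial : ∀ {v} → carrier W′ v → flat J v → v ≋ 𝟎
      W′∩J-trivial = transfer X (flat∈L J) W∩J-trivial

      dimI′ = dimension (spanOf-isSubspace β′ I)
      C = proj₁ (proj₂ dimI′)
      dimS′ = dimension (rowSpace-isSubspace (β′ ∘ χ))

      -- Within W′ the orthogonal complement of the span of the β′ (χ j) is W′ ∩ flat J, which is
      -- zero by `transfer`; hence these vectors span W′.
      s′≡k : proj₁ dimS′ ≡ k
      s′≡k = ≡.trans (≡.sym (ℕₚ.+-identityʳ _)) (orthogonal-dimension (proj₂ dimS′)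
        (hasDim-trivial (∩-isSubspace (gr-isSubspace W′) (flat-isSubspace J)) (λ (Wv , Jv) → W′∩J-trivial Wv Jv))
        (gr-hasDim W′) (RowSpace⊆ (gr-isSubspace W′) (β′ ∘ χ) (λ i → proj₁ (projβ′ (χ i)))) proj₁
        (λ {v} {w} (Wv , Jv) _ → trans (⟨⟩-cong {v = w} (W′∩J-trivial Wv Jv) (λ _ → refl)) (trans (⟨⟩-comm 𝟎 w) (⟨⟩-𝟎ʳ w)))
        (λ {v} Wv v⊥ → Wv , λ { _ (j , ≡.refl) →
          trans (projection-pairing (projβ′ (χ j)) Wv) (trans (⟨⟩-comm _ v) (v⊥ (row∈RowSpace (β′ ∘ χ) j))) }))

      -- Every φ i lies in I, so the e vectors β′ (ψ i) together with a basis C of the span over I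
      -- already span W′.
      k≤e+r′ : k ℕ.≤ e ℕ.+ proj₁ dimI′
      k≤e+r′ = ≡.subst (ℕ._≤ e ℕ.+ proj₁ dimI′) s′≡k (hasDim-≤-spanning (proj₂ dimS′) M (RowSpace⊆ M-sub (β′ ∘ χ) (↑-cases e
        (λ i → ≡.subst (RowSpace M) (≡.cong β′ (≡.sym (Fₚ.lookup-++ˡ ψ φ i)))
          (rowSpace-++ˡ (β′ ∘ ψ) C (row∈RowSpace (β′ ∘ ψ) i)))
        (λ i → ≡.subst (RowSpace M) (≡.cong β′ (≡.sym (Fₚ.lookup-++ʳ ψ φ i)))
          (rowSpace-++ʳ (β′ ∘ ψ) C (proj₁ (proj₂ (proj₂ (proj₂ dimI′))) (row∈spanOf β′ (proj₁ (proj₂ (A∈ i))))))))))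
        where
        M = (β′ ∘ ψ) F.++ C
        M-sub = rowSpace-isSubspace M

      conclusion : nullity W′ I ℕ.≤ nullity W I
      conclusion = ≡.subst (nullity W′ I ℕ.≤_)
        (ℕₚ.+-cancelʳ-≡ r e (nullity W I) (≡.trans e+r≡k (≡.trans (≡.sym (rank-nullity {W = W} projβ dimI)) (ℕₚ.+-comm r _))))
        (ℕₚ.+-cancelʳ-≤ (proj₁ dimI′) (nullity W′ I) e (ℕₚ.≤-trans
          (ℕₚ.≤-reflexive (≡.trans (ℕₚ.+-comm _ (proj₁ dimI′)) (rank-nullity {W = W′} projβ′ (proj₂ dimI′)))) k≤e+r′))

  -- Adjoint strata

  -- The set P ∩ H is again in the lattice and contains x, so it cannot be properly contained in P.
  openStratum-least : ∀ {V : Set} {ℓ} {𝒜 : Pred (Pred V 0ℓ) ℓ} {P H : Pred V 0ℓ} {x : V} →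
    (∀ {H K} → H ≐ K → 𝒜 H → 𝒜 K) → L 𝒜 P → openStratum 𝒜 P x → 𝒜 H → H x → P ⊆ H
  openStratum-least {𝒜 = 𝒜} {P} {H} 𝒜-≐ (ℬ , ℬ⊆ , P⊆ , ⊆P) (Px , minimal) 𝒜H Hx =
    proj₂ ∘ ¬¬-elim {P ⊆ P ∩ H} (λ P⊈ → minimal (P ∩ H) P∩H∈L (proj₁ , P⊈) (Px , Hx))
    where
    P∩H∈L : L 𝒜 (P ∩ H)
    P∩H∈L = (λ K → ℬ K ⊎ K ≐ H)
      , (λ { (inj₁ ℬK) → ℬ⊆ ℬK ; (inj₂ (K⊆ , ⊆K)) → 𝒜-≐ (⊆K , K⊆) 𝒜H })
      , (λ { (Pv , Hv) K (inj₁ ℬK) → P⊆ Pv K ℬK ; (Pv , Hv) K (inj₂ (_ , ⊆K)) → ⊆K Hv })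
      , (λ ⋂v → ⊆P (λ K ℬK → ⋂v K (inj₁ ℬK)) , ⋂v H (inj₂ (id , id)))

  -- The smallest member of L 𝒜 containing x; excluded middle brings it down
  -- to the lowest universe level.
  openStratum-exists : ∀ {V : Set} (𝒜 : Pred (Pred V 0ℓ) (lsuc 0ℓ)) (x : V) →
                       ∃ λ P → L 𝒜 P × openStratum 𝒜 P x
  openStratum-exists {V} 𝒜 x = P , (ℬ , proj₁ ∘ toWitness , P≐⋂ℬ) , Px , minimal
    where
    ℬ : Pred (Pred V 0ℓ) 0ℓ
    ℬ H = True (decide (𝒜 H × H x))
    P : Pred V 0ℓ
    P v = True (decide (⋂ ℬ v))
    P≐⋂ℬ : P ≐ ⋂ ℬ
    P≐⋂ℬ = toWitness , fromWitness
    Px : P x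
    Px = fromWitness (λ H ℬH → proj₂ (toWitness ℬH))
    minimal : ∀ Y → L 𝒜 Y → Y ⊂ P → ¬ Y x
    minimal Y (ℬ′ , ℬ′⊆ , Y⊆ , ⊆Y) (_ , P⊈Y) Yx = P⊈Y λ Pv → ⊆Y λ H ℬ′H →
      toWitness Pv H (fromWitness (ℬ′⊆ ℬ′H , Y⊆ Yx H ℬ′H))

  module AdjointStrata {n m k : ℕ} (α : Matrix m n) (essential : Essential (Arrangement α)) (k≤n : k ℕ.≤ n) where

    open Flats α
    open Essentially α essential {k}

    𝒜ᵏ : Pred (Pred (Coordinates n k) 0ℓ) (lsuc 0ℓ)
    𝒜ᵏ = Adjoint 𝒜 k

    adjoint-≐ : ∀ {H K} → H ≐ K → 𝒜ᵏ H → 𝒜ᵏ K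
    adjoint-≐ (H⊆ , ⊆H) (X , LX , H⊆X , X⊆H) = X , LX , H⊆X ∘ ⊆H , H⊆ ∘ X⊆H

    ∼⇒incidence : ∀ {W W′ H} → W ∼ W′ → 𝒜ᵏ H → H (Δ W) → H (Δ W′)
    ∼⇒incidence {W} {W′} W∼W′ (X , LX , H⊆ , ⊆H) HW = ⊆H (¬trivial⇒adjointHyperplane k≤n X W′ λ trivial′ →
      adjointHyperplane⇒¬trivial k≤n X W (H⊆ HW) λ Wv Xv → hasDim-0⇒trivial
        (∩-hasDim {W = W′} {W} (≡.sym ∘ W∼W′) LX
          (hasDim-trivial (∩-isSubspace (gr-isSubspace W′) (gr-isSubspace X)) (λ (Wv , Xv) → trivial′ Wv Xv)))
        (Wv , Xv))

    -- By contraposition the hypothesis says that a flat of rank k meeting W in zero also meets W′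
    -- in zero. One inclusion of incidences thus yields one inequality.
    incidence⇒nullity-≤ : ∀ {W W′} → (∀ {H} → 𝒜ᵏ H → H (Δ W′) → H (Δ W)) → ∀ I → nullity W′ I ℕ.≤ nullity W I
    incidence⇒nullity-≤ {W} {W′} incidence = trivialMeets⇒nullity-≤ {W} {W′} λ X LX trivial → ¬¬-elim λ ¬trivial′ →
      adjointHyperplane⇒¬trivial k≤n X W
        (incidence (X , LX , id , id) (¬trivial⇒adjointHyperplane k≤n X W′ ¬trivial′)) trivial

    stratum-incidence : ∀ (i : AdjointFlat 𝒜 k) {W W′ H} → adjointStratum 𝒜 i W → adjointStratum 𝒜 i W′ →
                        𝒜ᵏ H → H (Δ W) → H (Δ W′)
    stratum-incidence (P , LP) SW SW′ 𝒜H HW = openStratum-least adjoint-≐ LP SW 𝒜H HW (proj₁ SW′)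

    adjoint-classifies : Classifies (adjointStratum {k = k} 𝒜)
    adjoint-classifies = record
      { covers   = λ W → let P , LP , stratum = openStratum-exists 𝒜ᵏ (Δ W) in (P , LP) , stratum
      ; sound    = λ {i} {W} {W′} SW SW′ I → ℕₚ.≤-antisym
          (incidence⇒nullity-≤ {W′} {W} (stratum-incidence i {W} {W′} SW SW′) I)
          (incidence⇒nullity-≤ {W} {W′} (stratum-incidence i {W′} {W} SW′ SW) I)
      ; complete = λ { {P , ℬ , ℬ⊆ , P⊆ , ⊆P} {W} {W′} (PW , minimal) W∼W′ →
          ⊆P (λ H ℬH → ∼⇒incidence {W} {W′} W∼W′ (ℬ⊆ ℬH) (P⊆ PW H ℬH))
          , λ { Y LY@(ℬ′ , ℬ′⊆ , Y⊆ , ⊆Y) Y⊂P YW′ → minimal Y LY Y⊂P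
              (⊆Y λ H ℬ′H → ∼⇒incidence {W′} {W} (≡.sym ∘ W∼W′) (ℬ′⊆ ℬ′H) (Y⊆ YW′ H ℬ′H)) } }
      }

    adjoint-decomposition : IsDecomposition _≈ᴾ_ (adjointStratum {k = k} 𝒜)
    adjoint-decomposition = record
      { covers   = Classifies.covers adjoint-classifies
      ; disjoint = λ {i} {j} i≉j {W} (SW , TW) → i≉j (stratum-⊆ i j {W} SW TW , stratum-⊆ j i {W} TW SW)
      }
      where
      stratum-⊆ : ∀ (i j : AdjointFlat 𝒜 k) {W} → adjointStratum 𝒜 i W → adjointStratum 𝒜 j W → proj₁ i ⊆ proj₁ j
      stratum-⊆ (P , LP) (Q , ℬ , ℬ⊆ , Q⊆ , ⊆Q) {W} SW TW Pv = ⊆Q λ H ℬH →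
        openStratum-least adjoint-≐ LP SW (ℬ⊆ ℬH) (Q⊆ (proj₁ TW) H ℬH) Pv

  -- Maximal chains of flats

  -- If the given inclusion goes the other way, the dimensions agree and it can be reversed.
  chain-⊆ : ∀ {n d e} {X Y : Pred (ℝ^ n) 0ℓ} → X ⊆ Y ⊎ Y ⊆ X → HasDim X d → HasDim Y e → d ℕ.≤ e → X ⊆ Y
  chain-⊆ (inj₁ X⊆Y) dimX dimY d≤e = X⊆Y
  chain-⊆ (inj₂ Y⊆X) dimX dimY d≤e with ℕₚ.≤-antisym d≤e (hasDim-mono dimY dimX Y⊆X)
  ... | ≡.refl = hasDim-full dimY dimX Y⊆X

  greatest-below : (P : ℕ → Set₁) → P 0 → ∀ j → ∃ λ d → d ℕ.≤ j × P d × (∀ e → e ℕ.≤ j → P e → e ℕ.≤ d)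
  greatest-below P P0 zero    = 0 , z≤n , P0 , λ _ e≤0 _ → e≤0
  greatest-below P P0 (suc j) with decide (P (suc j))
  ... | yes Pj = suc j , ℕₚ.≤-refl , Pj , λ _ e≤ _ → e≤
  ... | no ¬Pj with greatest-below P P0 j
  ...   | d , d≤j , Pd , greatest = d , ℕₚ.m≤n⇒m≤1+n d≤j , Pd , bound
    where
    bound : ∀ e → e ℕ.≤ suc j → P e → e ℕ.≤ d
    bound e e≤1+j Pe with ℕₚ.m≤n⇒m<n∨m≡n e≤1+j
    ... | inj₁ (s≤s e≤j) = greatest e e≤j Pe
    ... | inj₂ ≡.refl    = contradiction Pe ¬Pj

  module Chains {n m : ℕ} (α : Matrix m n) (essential : Essential (Arrangement α)) where

    open Flats α
    open Essentially α essential {0} using (𝒜; normals-span)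

    separate : ∀ {Z y} → L 𝒜 Z → ¬ Z y → ∃ λ i → Z ⊆ hyperplane (α i) × ⟨ α i , y ⟩ ≉ 0#
    separate {Z} {y} LZ y∉Z =
      let J , Z⊆J , J⊆Z = L⇒flat LZ
          i , Ji , αy≉0 = ¬¬-elim {∃ λ i → J i × ⟨ α i , y ⟩ ≉ 0#}
            (λ none → y∉Z (J⊆Z λ i Ji → ¬¬-elim (λ αy≉0 → none (i , Ji , αy≉0))))
      in i , (λ Zv → Z⊆J Zv i Ji) , αy≉0

    ⊈⇒∃ : ∀ {Y Z : Pred (ℝ^ n) 0ℓ} → ¬ Y ⊆ Z → ∃ λ y → Y y × ¬ Z y
    ⊈⇒∃ Y⊈Z = ¬¬-elim (λ none → Y⊈Z (λ {y} Yy → ¬¬-elim (λ y∉Z → none (y , Yy , y∉Z))))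

    module _ (C : MaximalChain 𝒜) where

      open MaximalChain C hiding (members)

      member-isSubspace : ∀ {X} → members C X → IsSubspace X
      member-isSubspace = L-isSubspace ∘ flats

      insert : ∀ {Y} → L 𝒜 Y → (∀ {X} → members C X → X ⊆ Y ⊎ Y ⊆ X) → members C Y
      insert {Y} LY comparable = maximal D D⊆L D-chain inj₁ (inj₂ (id , id))
        where
        D : Pred (Pred (ℝ^ n) 0ℓ) 0ℓ
        D Z = members C Z ⊎ Z ≐ Y
        D⊆L : D ⊆ L 𝒜
        D⊆L (inj₁ CZ)         = flats CZ
        D⊆L (inj₂ (Z⊆ , ⊆Z)) = L-≐ (⊆Z , Z⊆) LY
        D-chain : IsChain D
        D-chain (inj₁ CX) (inj₁ CZ) = isChain CX CZ
        D-chain (inj₁ CX) (inj₂ (Z⊆ , ⊆Z)) with comparable CX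
        ... | inj₁ X⊆Y = inj₁ (⊆Z ∘ X⊆Y)
        ... | inj₂ Y⊆X = inj₂ (Y⊆X ∘ Z⊆)
        D-chain (inj₂ (X⊆ , ⊆X)) (inj₁ CZ) with comparable CZ
        ... | inj₁ Z⊆Y = inj₂ (⊆X ∘ Z⊆Y)
        ... | inj₂ Y⊆Z = inj₁ (Y⊆Z ∘ X⊆)
        D-chain (inj₂ (X⊆ , _)) (inj₂ (_ , ⊆Z)) = inj₁ (⊆Z ∘ X⊆)

      members-≐ : ∀ {X Y} → members C X → X ≐ Y → members C Y
      members-≐ {X} {Y} CX (X⊆Y , Y⊆X) = insert (L-≐ (X⊆Y , Y⊆X) (flats CX)) comparable
        where
        comparable : ∀ {Z} → members C Z → Z ⊆ Y ⊎ Y ⊆ Z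
        comparable CZ with isChain CZ CX
        ... | inj₁ Z⊆X = inj₁ (X⊆Y ∘ Z⊆X)
        ... | inj₂ X⊆Z = inj₂ (X⊆Z ∘ Y⊆X)

      MemberOfDim : ℕ → Set₁
      MemberOfDim d = ∃ λ X → members C X × HasDim X d

      trivial-member : MemberOfDim 0
      trivial-member = flat (const ⊤)
        , insert (flat∈L _) (λ CX → inj₂ (λ v∈ → let S = member-isSubspace CX in ∋-resp S (≋-sym (trivial v∈)) (∋-𝟎 S)))
        , hasDim-trivial (flat-isSubspace _) trivial
        where
        trivial : ∀ {v} → flat (const ⊤) v → v ≋ 𝟎
        trivial v∈ = normals-span (λ i → v∈ i tt)

      full-member : MemberOfDim n
      full-member = flat (const ⊥)
        , insert (flat∈L _) (λ _ → inj₁ (λ _ _ ()))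
        , hasDim-≐ ((λ _ _ ()) , _) hasDim-full-space

      -- Intersect Y with a hyperplane that contains the largest member of
      -- dimension at most j but not Y.
      member-below : ∀ {j} → MemberOfDim (suc j) → MemberOfDim j
      member-below {j} (Y , CY , dimY) with greatest-below MemberOfDim trivial-member j
      ... | d , d≤j , (Z , CZ , dimZ) , greatest
        with ⊈⇒∃ (λ (Y⊆Z : Y ⊆ Z) → ℕₚ.1+n≰n (ℕₚ.≤-trans (hasDim-mono dimY dimZ Y⊆Z) d≤j))
      ... | y , Yy , y∉Z with separate (flats CZ) y∉Z
      ... | i , Z⊆H , αy≉0 with dimension (L-isSubspace (L-section i (flats CY)))
      ... | e , dimY′ = Y ∩ hyperplane (α i) , insert (L-section i (flats CY)) comparable
        , ≡.subst (HasDim _) (≡.sym (ℕₚ.suc-injective (section-dim (α i) Yy αy≉0 dimY dimY′))) dimY′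
        where
        -- A member of dimension at most j lies in Z by the choice of Z, hence in the hyperplane;
        -- one of larger dimension contains Y, which has dimension j + 1.
        comparable : ∀ {X} → members C X → X ⊆ Y ∩ hyperplane (α i) ⊎ Y ∩ hyperplane (α i) ⊆ X
        comparable CX with dimension (member-isSubspace CX)
        ... | x , dimX with ℕₚ.≤-<-connex x j
        ... | inj₁ x≤j = inj₁ λ Xv →
                chain-⊆ (isChain CX CY) dimX dimY (ℕₚ.m≤n⇒m≤1+n x≤j) Xv
              , Z⊆H (chain-⊆ (isChain CX CZ) dimX dimZ (greatest x x≤j (_ , CX , dimX)) Xv)
        ... | inj₂ j<x = inj₂ (chain-⊆ (isChain CY CX) dimY dimX j<x ∘ proj₁)

      memberOfDim : ∀ t j → j ℕ.+ t ≡ n → MemberOfDim j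
      memberOfDim zero    j e = ≡.subst MemberOfDim (≡.trans (≡.sym e) (ℕₚ.+-identityʳ j)) full-member
      memberOfDim (suc t) j e = member-below (memberOfDim t (suc j) (≡.trans (≡.sym (ℕₚ.+-suc j t)) e))

      flagMember : ∀ (i : Fin (suc n)) → MemberOfDim (toℕ i)
      flagMember i = memberOfDim (n ∸ toℕ i) (toℕ i) (ℕₚ.m+[n∸m]≡n (Finₚ.toℕ≤pred[n] i))

      flagOf : CompleteFlag n
      flagOf = record
        { space  = proj₁ ∘ flagMember
        ; hasDim = hasDimᶠ
        ; strict = λ i →
            let dimᵢ  = ≡.subst (HasDim _) (Finₚ.toℕ-inject₁ i) (hasDimᶠ (inject₁ i))
                dimᵢ₊ = hasDimᶠ (suc i)
            in chain-⊆ (isChain (proj₁ (proj₂ (flagMember (inject₁ i)))) (proj₁ (proj₂ (flagMember (suc i)))))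
                 dimᵢ dimᵢ₊ (ℕₚ.n≤1+n (toℕ i))
             , λ ⊆ᵢ → ℕₚ.1+n≰n (hasDim-mono dimᵢ₊ dimᵢ ⊆ᵢ)
        }
        where
        hasDimᶠ : ∀ i → HasDim (proj₁ (flagMember i)) (toℕ i)
        hasDimᶠ i = proj₂ (proj₂ (flagMember i))

      members-same-dim : ∀ {X Y d} → members C X → members C Y → HasDim X d → HasDim Y d → X ≐ Y
      members-same-dim CX CY dimX dimY =
        chain-⊆ (isChain CX CY) dimX dimY ℕₚ.≤-refl , chain-⊆ (isChain CY CX) dimY dimX ℕₚ.≤-refl

      flagOf-isFlag : C IsFlag flagOf
      flagOf-isFlag =
          (λ CX → let x , dimX = dimension (member-isSubspace CX)
                      x≤n = hasDim-mono dimX hasDim-full-space _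
                      i = fromℕ< (s≤s x≤n)
                  in i , members-same-dim CX (proj₁ (proj₂ (flagMember i))) dimX
                           (≡.subst (HasDim _) (Finₚ.toℕ-fromℕ< (s≤s x≤n)) (proj₂ (proj₂ (flagMember i)))))
        , (λ (i , X⊆ , ⊆X) → members-≐ (proj₁ (proj₂ (flagMember i))) (⊆X , X⊆))

    -- Maximal chains from lists of hyperplanes

    flatL : List (Fin m) → Pred (ℝ^ n) 0ℓ
    flatL []       = const ⊤
    flatL (i ∷ is) = flatL is ∩ hyperplane (α i)

    flatL∈L : ∀ is → L 𝒜 (flatL is)
    flatL∈L []       = L-≐ (_ , (λ _ _ ())) (flat∈L (const ⊥))
    flatL∈L (i ∷ is) = L-section i (flatL∈L is)

    flatL-tabulate⁺ : ∀ {d} (f : Fin d → Fin m) {v} → (∀ j → hyperplane (α (f j)) v) → flatL (tabulate f) v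
    flatL-tabulate⁺ {zero}  f h = tt
    flatL-tabulate⁺ {suc d} f h = flatL-tabulate⁺ (f ∘ suc) (h ∘ suc) , h zero

    flatL-tabulate⁻ : ∀ {d} (f : Fin d → Fin m) {v} → flatL (tabulate f) v → ∀ j → hyperplane (α (f j)) v
    flatL-tabulate⁻ f (v∈ , h) zero    = h
    flatL-tabulate⁻ f (v∈ , h) (suc j) = flatL-tabulate⁻ (f ∘ suc) v∈ j

    flatL-++ˡ : ∀ is {js} → flatL (is ++ js) ⊆ flatL is
    flatL-++ˡ []       _        = tt
    flatL-++ˡ (i ∷ is) (v∈ , h) = flatL-++ˡ is v∈ , h

    -- The flats cut out by the suffixes of a list, closed under `_≐_`. A suffix longer by one
    -- imposes one more hyperplane, so this is a chain in which the dimension drops by at most one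
    -- at a time.
    Suffixes : List (Fin m) → Pred (Pred (ℝ^ n) 0ℓ) 0ℓ
    Suffixes []       X = X ≐ flatL []
    Suffixes (i ∷ is) X = X ≐ flatL (i ∷ is) ⊎ Suffixes is X

    suffix-refl : ∀ is → Suffixes is (flatL is)
    suffix-refl []       = id , id
    suffix-refl (i ∷ is) = inj₁ (id , id)

    suffix-++ : ∀ is js → Suffixes (is ++ js) (flatL js)
    suffix-++ []       js = suffix-refl js
    suffix-++ (i ∷ is) js = inj₂ (suffix-++ is js)

    suffix-≐ : ∀ is {X Y} → X ≐ Y → Suffixes is X → Suffixes is Y
    suffix-≐ []       (X⊆Y , Y⊆X) (X⊆ , ⊆X)        = X⊆ ∘ Y⊆X , X⊆Y ∘ ⊆X
    suffix-≐ (i ∷ is) (X⊆Y , Y⊆X) (inj₁ (X⊆ , ⊆X)) = inj₁ (X⊆ ∘ Y⊆X , X⊆Y ∘ ⊆X)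
    suffix-≐ (i ∷ is) X≐Y         (inj₂ s)         = inj₂ (suffix-≐ is X≐Y s)

    suffix-⊇ : ∀ is {X} → Suffixes is X → flatL is ⊆ X
    suffix-⊇ []       (_ , ⊆X)        = ⊆X
    suffix-⊇ (i ∷ is) (inj₁ (_ , ⊆X)) = ⊆X
    suffix-⊇ (i ∷ is) (inj₂ s)        = suffix-⊇ is s ∘ proj₁

    suffix-L : ∀ is → Suffixes is ⊆ L 𝒜
    suffix-L []       (X⊆ , ⊆X)        = L-≐ (⊆X , X⊆) (flatL∈L [])
    suffix-L (i ∷ is) (inj₁ (X⊆ , ⊆X)) = L-≐ (⊆X , X⊆) (flatL∈L (i ∷ is))
    suffix-L (i ∷ is) (inj₂ s)         = suffix-L is s

    suffix-chain : ∀ is → IsChain (Suffixes is)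
    suffix-chain []       (X⊆ , _)        (_ , ⊆Y)        = inj₁ (⊆Y ∘ X⊆)
    suffix-chain (i ∷ is) (inj₁ (X⊆ , _)) t               = inj₁ (suffix-⊇ (i ∷ is) t ∘ X⊆)
    suffix-chain (i ∷ is) (inj₂ s)        (inj₁ (Y⊆ , _)) = inj₂ (suffix-⊇ is s ∘ proj₁ ∘ Y⊆)
    suffix-chain (i ∷ is) (inj₂ s)        (inj₂ t)        = suffix-chain is s t

    -- A discrete intermediate value argument: by `section-dim-≤` no dimension is skipped on the way
    -- from the full space down to e.
    suffix-of-dim : ∀ is {d e} → HasDim (flatL is) e → e ℕ.≤ d → d ℕ.≤ n → ∃ λ X → Suffixes is X × HasDim X d
    suffix-of-dim [] dim e≤d d≤n with hasDim-unique dim hasDim-full-space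
    ... | ≡.refl with ℕₚ.≤-antisym e≤d d≤n
    ... | ≡.refl = flatL [] , (id , id) , dim
    suffix-of-dim (i ∷ is) dim e≤d d≤n with ℕₚ.m≤n⇒m<n∨m≡n e≤d
    ... | inj₂ ≡.refl = flatL (i ∷ is) , inj₁ (id , id) , dim
    ... | inj₁ e<d    =
      let e′ , dim′ = dimension (L-isSubspace (flatL∈L is))
          X , s , dimX = suffix-of-dim is dim′ (ℕₚ.≤-trans (section-dim-≤ (α i) dim′ dim) e<d) d≤n
      in X , inj₂ s , dimX

    -- Maximality holds because members of all dimensions from 0 to n occur: a further flat
    -- comparable with them equals the member of its own dimension.
    suffixChain : ∀ is → HasDim (flatL is) 0 → MaximalChain 𝒜
    suffixChain is dim = record
      { members = Suffixes is
      ; flats   = suffix-L is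
      ; isChain = suffix-chain is
      ; maximal = λ D D⊆L D-chain ⊆D DY →
          let d , dimY = dimension (L-isSubspace (D⊆L DY))
              X , s , dimX = suffix-of-dim is dim z≤n (hasDim-mono dimY hasDim-full-space _)
          in suffix-≐ is ( chain-⊆ (D-chain (⊆D s) DY) dimX dimY ℕₚ.≤-refl
                         , chain-⊆ (D-chain DY (⊆D s)) dimY dimX ℕₚ.≤-refl) s
      }

    element∈ : ∀ {m} (I : Subset m) j → element I j Sub.∈ I
    element∈ (inside  Vec.∷ I) zero    = Vec.here
    element∈ (inside  Vec.∷ I) (suc j) = Vec.there (element∈ I j)
    element∈ (outside Vec.∷ I) j       = Vec.there (element∈ I j)

    -- All indices are put in front of those of I. The suffix listing I cuts out the wanted flat,
    -- and the whole list reaches dimension 0 by essentiality.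
    maximalChain-through : ∀ I → ∃ λ C → members C (flat (Sub._∈ I))
    maximalChain-through I = suffixChain (tabulate id ++ tabulate (element I))
        (hasDim-trivial (L-isSubspace (flatL∈L (tabulate id ++ tabulate (element I))))
          (λ v∈ → normals-span (flatL-tabulate⁻ id (flatL-++ˡ (tabulate id) v∈))))
      , suffix-≐ (tabulate id ++ tabulate (element I)) (⊆flat , flat⊆) (suffix-++ (tabulate id) (tabulate (element I)))
      where
      ⊆flat : flatL (tabulate (element I)) ⊆ flat (Sub._∈ I)
      ⊆flat {v} v∈ i i∈I = let j , e = element-surjective i∈I
                       in ≡.subst (λ i → hyperplane (α i) v) e (flatL-tabulate⁻ (element I) v∈ j)
      flat⊆ : flat (Sub._∈ I) ⊆ flatL (tabulate (element I))
      flat⊆ v∈ = flatL-tabulate⁺ (element I) (λ j → v∈ (element I j) (element∈ I j))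

  -- Schubert strata

  support-cong : ∀ {m} {J K : Pred (Fin m) 0ℓ} → J ≐ K → support J ≡ support K
  support-cong (J⊆K , K⊆J) = Subₚ.⊆-antisym
    (∈-support⁺ ∘ J⊆K ∘ ∈-support⁻) (∈-support⁺ ∘ K⊆J ∘ ∈-support⁻)

  ⊆∧∣∣≡⇒≡ : ∀ {m} {p q : Subset m} → p Sub.⊆ q → ∣ p ∣ ≡ ∣ q ∣ → p ≡ q
  ⊆∧∣∣≡⇒≡ {p = p} {q} p⊆q ∣p∣≡∣q∣ = Subₚ.⊆-antisym p⊆q λ {x} x∈q → ¬¬-elim λ x∉p →
    ℕₚ.<-irrefl ∣p∣≡∣q∣ (Subₚ.p⊂q⇒∣p∣<∣q∣ (p⊆q , x , x∈q , x∉p))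

  -- Functions with steps of at most one and their jump sets

  Jumps : ∀ {n} → (Fin (suc n) → ℕ) → Pred (Fin n) 0ℓ
  Jumps f i = f (inject₁ i) < f (suc i)

  UnitSteps : ∀ {n} → (Fin (suc n) → ℕ) → Set
  UnitSteps f = ∀ i → f (inject₁ i) ℕ.≤ f (suc i) × f (suc i) ℕ.≤ suc (f (inject₁ i))

  unitStep : ∀ {a b} → a ℕ.≤ b → b ℕ.≤ suc a → (a < b × b ≡ suc a) ⊎ (¬ a < b × b ≡ a)
  unitStep a≤b b≤1+a with ℕₚ.m≤n⇒m<n∨m≡n a≤b
  ... | inj₁ a<b    = inj₁ (a<b , ℕₚ.≤-antisym b≤1+a a<b)
  ... | inj₂ ≡.refl = inj₂ (ℕₚ.<-irrefl ≡.refl , ≡.refl)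

  ∣jumps∣ : ∀ {n} (f : Fin (suc n) → ℕ) → UnitSteps f → f zero ℕ.+ ∣ support (Jumps f) ∣ ≡ f (fromℕ n)
  ∣jumps∣ {zero}  f steps = ℕₚ.+-identityʳ (f zero)
  ∣jumps∣ {suc n} f steps with unitStep (proj₁ (steps zero)) (proj₂ (steps zero)) | decide₀ (Jumps f zero)
  ... | inj₁ (_ , f₁≡) | yes _ =
    ≡.trans (ℕₚ.+-suc (f zero) _) (≡.trans (≡.cong (ℕ._+ ∣ support (Jumps (f ∘ suc)) ∣) (≡.sym f₁≡)) (∣jumps∣ (f ∘ suc) (steps ∘ suc)))
  ... | inj₂ (_ , f₁≡) | no _ =
    ≡.trans (≡.cong (ℕ._+ ∣ support (Jumps (f ∘ suc)) ∣) (≡.sym f₁≡)) (∣jumps∣ (f ∘ suc) (steps ∘ suc))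
  ... | inj₁ (f₀<f₁ , _) | no  f₀≮f₁ = contradiction f₀<f₁ f₀≮f₁
  ... | inj₂ (f₀≮f₁ , _) | yes f₀<f₁ = contradiction f₀<f₁ f₀≮f₁

  jumps-determine : ∀ {n} (f g : Fin (suc n) → ℕ) → UnitSteps f → UnitSteps g → f zero ≡ g zero →
                    Jumps f ≐ Jumps g → f ≗ g
  jumps-determine         f g sf sg f₀≡g₀ J≐ zero = f₀≡g₀
  jumps-determine {suc n} f g sf sg f₀≡g₀ J≐@(J⊆ , ⊆J) (suc i) =
    jumps-determine (f ∘ suc) (g ∘ suc) (sf ∘ suc) (sg ∘ suc) f₁≡g₁ (J⊆ , ⊆J) i
    where
    f₁≡g₁ : f (suc zero) ≡ g (suc zero)
    f₁≡g₁ with unitStep (proj₁ (sf zero)) (proj₂ (sf zero)) | unitStep (proj₁ (sg zero)) (proj₂ (sg zero))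
    ... | inj₁ (_ , e)   | inj₁ (_ , e′)  = ≡.trans e (≡.trans (≡.cong suc f₀≡g₀) (≡.sym e′))
    ... | inj₂ (_ , e)   | inj₂ (_ , e′)  = ≡.trans e (≡.trans f₀≡g₀ (≡.sym e′))
    ... | inj₁ (f< , _)  | inj₂ (g≮ , _)  = contradiction (J⊆ f<) g≮
    ... | inj₂ (f≮ , _)  | inj₁ (g< , _)  = contradiction (⊆J g<) f≮

  module SchubertStrata {n m k : ℕ} (α : Matrix m n) (essential : Essential (Arrangement α)) where

    open Flats α
    open Essentially α essential {k}
    open Chains α essential

    module _ (W : Gr k n) (Φ : CompleteFlag n) where

      private
        meetDim : ∀ i → ∃ (HasDim (carrier W ∩ space Φ i))
        meetDim i = dimension (∩-isSubspace (gr-isSubspace W) (hasDim⇒isSubspace (CompleteFlag.hasDim Φ i)))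

      profile : Fin (suc n) → ℕ
      profile i = proj₁ (meetDim i)

      profile-hasDim : ∀ i → HasDim (carrier W ∩ space Φ i) (profile i)
      profile-hasDim i = proj₂ (meetDim i)

      profile-first : profile zero ≡ 0
      profile-first = ℕₚ.n≤0⇒n≡0 (hasDim-mono (profile-hasDim zero) (CompleteFlag.hasDim Φ zero) proj₂)

      profile-last : profile (fromℕ n) ≡ k
      profile-last = hasDim-unique (profile-hasDim (fromℕ n)) (hasDim-≐ ((λ Wv → Wv , full tt) , proj₁) (gr-hasDim W))
        where
        full : const ⊤ ⊆ space Φ (fromℕ n)
        full = hasDim-full (≡.subst (HasDim _) (Finₚ.toℕ-fromℕ n) (CompleteFlag.hasDim Φ (fromℕ n))) hasDim-full-space _

      jumps : Subset n
      jumps = support (Jumps profile)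

    profile-cong : ∀ {W W′ : Gr k n} {Φ Ψ : CompleteFlag n} i → carrier W ∩ space Φ i ≐ carrier W′ ∩ space Ψ i →
                   profile W Φ i ≡ profile W′ Ψ i
    profile-cong {W} {W′} {Φ} {Ψ} i ≐ᵢ =
      hasDim-unique (hasDim-≐ ≐ᵢ (profile-hasDim W Φ i)) (profile-hasDim W′ Ψ i)

    module _ (C : MaximalChain 𝒜) {Φ : CompleteFlag n} (isFlag : C IsFlag Φ) where

      space∈ : ∀ i → members C (space Φ i)
      space∈ i = proj₂ isFlag (i , id , id)

      -- The hyperplane that separates consecutive members of the flag cuts
      -- the larger one down to the smaller one, so W meets it in dimension
      -- at most one less.
      profile-unitSteps : ∀ W → UnitSteps (profile W Φ)
      profile-unitSteps W i with CompleteFlag.strict Φ i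
      ... | Φᵢ⊆ , ⊈Φᵢ with ⊈⇒∃ ⊈Φᵢ
      ... | y , Φy , y∉ with separate (MaximalChain.flats C (space∈ (inject₁ i))) y∉
      ... | j , Φᵢ⊆H , αy≉0 =
          hasDim-mono (profile-hasDim W Φ (inject₁ i)) (profile-hasDim W Φ (suc i)) (λ (Wv , Φv) → Wv , Φᵢ⊆ Φv)
        , ℕₚ.≤-trans (section-dim-≤ (α j) (profile-hasDim W Φ (suc i)) (proj₂ section))
            (s≤s (hasDim-mono (proj₂ section) (profile-hasDim W Φ (inject₁ i))
              (λ ((Wv , Φv) , Hv) → Wv , cut⊆ (Φv , Hv))))
        where
        LΦ = MaximalChain.flats C (space∈ (suc i))
        section = dimension (∩-isSubspace (∩-isSubspace (gr-isSubspace W) (L-isSubspace LΦ)) (hyperplane-isSubspace (α j)))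
        cut = dimension (L-isSubspace (L-section j LΦ))
        cut⊆ : space Φ (suc i) ∩ hyperplane (α j) ⊆ space Φ (inject₁ i)
        cut⊆ = hasDim-full
          (≡.subst (HasDim _) (≡.trans (Finₚ.toℕ-inject₁ i)
            (ℕₚ.suc-injective (section-dim (α j) Φy αy≉0 (CompleteFlag.hasDim Φ (suc i)) (proj₂ cut))))
            (CompleteFlag.hasDim Φ (inject₁ i)))
          (proj₂ cut) (λ Φᵢv → Φᵢ⊆ Φᵢv , Φᵢ⊆H Φᵢv)

      ∣jumps∣≡k : ∀ W → ∣ jumps W Φ ∣ ≡ k
      ∣jumps∣≡k W = ≡.trans (≡.cong (ℕ._+ ∣ jumps W Φ ∣) (≡.sym (profile-first W Φ)))
        (≡.trans (∣jumps∣ (profile W Φ) (profile-unitSteps W)) (profile-last W Φ))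

      jumps-cell : ∀ W → schubertCell Φ (jumps W Φ , ∣jumps∣≡k W) W
      jumps-cell W i i∈ = profile W Φ (suc i) , profile W Φ (inject₁ i)
        , profile-hasDim W Φ (suc i) , profile-hasDim W Φ (inject₁ i) , ∈-support⁻ i∈

      -- The cell condition gives only that τ is contained in the jump set; both have k elements,
      -- which forces equality.
      cell⇒≡jumps : ∀ {τ W} → schubertCell Φ τ W → proj₁ τ ≡ jumps W Φ
      cell⇒≡jumps {τ , ∣τ∣≡k} {W} cell = ⊆∧∣∣≡⇒≡
        (λ {i} i∈τ → let d , e , dim , dim′ , e<d = cell i i∈τ in ∈-support⁺
          (≡.subst₂ _<_ (hasDim-unique dim′ (profile-hasDim W Φ (inject₁ i)))
                        (hasDim-unique dim (profile-hasDim W Φ (suc i))) e<d))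
        (≡.trans ∣τ∣≡k (≡.sym (∣jumps∣≡k W)))

    -- A stratum asks for the existence of a flag for each chain, so different points may bring
    -- different flags; this makes them interchangeable.
    isFlag-unique : ∀ {C E : MaximalChain 𝒜} {Φ Ψ} → members C ≐ members E → C IsFlag Φ → E IsFlag Ψ →
                    ∀ i → space Φ i ≐ space Ψ i
    isFlag-unique {C} {E} {Φ} {Ψ} C≐E CΦ EΨ i = members-same-dim C (space∈ C {Φ} CΦ i)
      (proj₂ C≐E (space∈ E {Ψ} EΨ i)) (CompleteFlag.hasDim Φ i) (CompleteFlag.hasDim Ψ i)

    jumps-unique : ∀ {C E : MaximalChain 𝒜} {Φ Ψ} W → members C ≐ members E → C IsFlag Φ → E IsFlag Ψ →
                   jumps W Φ ≡ jumps W Ψ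
    jumps-unique {C} {E} {Φ} {Ψ} W C≐E CΦ EΨ = support-cong
      ( (λ {i} → ≡.subst₂ _<_ (profile≡ (inject₁ i)) (profile≡ (suc i)))
      , (λ {i} → ≡.subst₂ _<_ (≡.sym (profile≡ (inject₁ i))) (≡.sym (profile≡ (suc i)))))
      where
      profile≡ : profile W Φ ≗ profile W Ψ
      profile≡ i = let ⊆ᵢ , ⊇ᵢ = isFlag-unique {C} {E} {Φ} {Ψ} C≐E CΦ EΨ i
                   in profile-cong {W} {W} {Φ} {Ψ} i ((λ (Wv , v) → Wv , ⊆ᵢ v) , (λ (Wv , v) → Wv , ⊇ᵢ v))

    -- The symbol is read off from W along the flags `flagOf`, and W itself witnesses that the
    -- stratum is nonempty.
    generic-stratum : (W : Gr k n) → ∃ λ (σ : SchubertSymbol 𝒜 k) → schubertStratum 𝒜 σ W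
    generic-stratum W = record
      { symbol   = symbol′
      ; respects = λ C E C≐E → jumps-unique {C} {E} {flagOf C} {flagOf E} W C≐E (flagOf-isFlag C) (flagOf-isFlag E)
      ; nonempty = W , stratum
      } , stratum
      where
      symbol′ : MaximalChain 𝒜 → KSubset n k
      symbol′ C = jumps W (flagOf C) , ∣jumps∣≡k C {flagOf C} (flagOf-isFlag C) W
      stratum : schubertStratumOf 𝒜 symbol′ W
      stratum C = flagOf C , flagOf-isFlag C , jumps-cell C {flagOf C} (flagOf-isFlag C) W

    schubert-classifies : Classifies (schubertStratum {k = k} 𝒜)
    schubert-classifies = record
      { covers   = generic-stratum
      ; sound    = λ {σ} {W} {W′} → sound {σ} {W} {W′}
      ; complete = λ {σ} {W} {W′} → complete {σ} {W} {W′}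
      }
      where
      sound : ∀ {σ : SchubertSymbol 𝒜 k} {W W′} → schubertStratum 𝒜 σ W → schubertStratum 𝒜 σ W′ → W ∼ W′
      sound {σ} {W} {W′} SW SW′ I with maximalChain-through I
      ... | C , I∈C with SW C | SW′ C
      ... | Φ , CΦ , cell | Ψ , CΨ , cell′ with proj₁ CΦ I∈C
      ... | i , I⊆Φᵢ , Φᵢ⊆I with isFlag-unique {C} {C} {Φ} {Ψ} (id , id) CΦ CΨ i
      ... | Φᵢ⊆Ψᵢ , Ψᵢ⊆Φᵢ = ≡.trans
          (hasDim-unique (hasNullity W I) (hasDim-≐ ((λ (Wv , v) → Wv , Φᵢ⊆I v) , (λ (Wv , v) → Wv , I⊆Φᵢ v)) (profile-hasDim W Φ i)))
          (≡.trans (profiles i)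
            (hasDim-unique (profile-hasDim W′ Ψ i)
              (hasDim-≐ ((λ (Wv , v) → Wv , Φᵢ⊆Ψᵢ (I⊆Φᵢ v)) , (λ (Wv , v) → Wv , Φᵢ⊆I (Ψᵢ⊆Φᵢ v))) (hasNullity W′ I))))
        where
        jumps≡ : jumps W Φ ≡ jumps W′ Ψ
        jumps≡ = ≡.trans (≡.sym (cell⇒≡jumps C {Φ} CΦ {symbol σ C} {W} cell)) (cell⇒≡jumps C {Ψ} CΨ {symbol σ C} {W′} cell′)
        profiles : profile W Φ ≗ profile W′ Ψ
        profiles = jumps-determine (profile W Φ) (profile W′ Ψ)
          (profile-unitSteps C {Φ} CΦ W) (profile-unitSteps C {Ψ} CΨ W′)
          (≡.trans (profile-first W Φ) (≡.sym (profile-first W′ Ψ)))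
          ( (λ j → ∈-support⁻ (≡.subst (_ Sub.∈_) jumps≡ (∈-support⁺ j)))
          , (λ j → ∈-support⁻ (≡.subst (_ Sub.∈_) (≡.sym jumps≡) (∈-support⁺ j))))

      complete : ∀ {σ : SchubertSymbol 𝒜 k} {W W′} → schubertStratum 𝒜 σ W → W ∼ W′ → schubertStratum 𝒜 σ W′
      complete {σ} {W} {W′} SW W∼W′ C =
        let Φ , CΦ , cell = SW C
            transfer : ∀ {i d} → HasDim (carrier W ∩ space Φ i) d → HasDim (carrier W′ ∩ space Φ i) d
            transfer {i} = ∩-hasDim {W = W} {W′} W∼W′ (MaximalChain.flats C (space∈ C {Φ} CΦ i))
        in Φ , CΦ , λ i i∈τ →
          let d , e , dim , dim′ , e<d = cell i i∈τ
          in d , e , transfer dim , transfer dim′ , e<d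

    schubert-decomposition : IsDecomposition _≈ˢ_ (schubertStratum {k = k} 𝒜)
    schubert-decomposition = record
      { covers   = generic-stratum
      ; disjoint = λ {σ} {τ} σ≉τ {W} (SW , TW) → σ≉τ λ C →
          let Φ , CΦ , cell = SW C
              Ψ , CΨ , cell′ = TW C
          in ≡.trans (cell⇒≡jumps C {Φ} CΦ {symbol σ C} {W} cell)
               (≡.trans (jumps-unique {C} {C} {Φ} {Ψ} W (id , id) CΦ CΨ)
                 (≡.sym (cell⇒≡jumps C {Ψ} CΨ {symbol τ C} {W} cell′)))
      }

theorem1p2 :
    ExcludedMiddle (lsuc 0ℓ) →
    (ℝ : RealNumbers) → let open Over ℝ in
    (n m k : ℕ) (α : Fin m → ℝ^ n) →
    (∀ i → ¬ (α i ≋ 𝟎)) →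
    Essential (Arrangement α) →
    k < n →
    IsDecomposition _≈ᴹ_ (matroidStratum {k = k} α) ×
    IsDecomposition _≈ᴾ_ (adjointStratum {k = k} (Arrangement α)) ×
    IsDecomposition _≈ˢ_ (schubertStratum {k = k} (Arrangement α)) ×
    (NonemptyStrata (matroidStratum {k = k} α)
       ≐ NonemptyStrata (adjointStratum {k = k} (Arrangement α))) ×
    (NonemptyStrata (adjointStratum {k = k} (Arrangement α))
       ≐ NonemptyStrata (schubertStratum {k = k} (Arrangement α)))
theorem1p2 em ℝ n m k α _ essential k<n =
    matroid-decomposition
  , adjoint-decomposition
  , schubert-decomposition
  , (nonemptyStrata-⊆ matroid-classifies adjoint-classifies , nonemptyStrata-⊆ adjoint-classifies matroid-classifies)
  , (nonemptyStrata-⊆ adjoint-classifies schubert-classifies , nonemptyStrata-⊆ schubert-classifies adjoint-classifies)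
  where
  open Development em ℝ
  open Essentially α essential {k}
  open AdjointStrata α essential (ℕₚ.<⇒≤ k<n)
  open SchubertStrata {k = k} α essential
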